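{- Let $G$ be a finite product of finite $p$-groups, where each factor is a $p$-group for some prime $p\ge5$. Then for every $\varepsilon>0$, every $n$ and every function $f:\{0,1\}^n\to G$, $|\mathsf{List}^f_\varepsilon|\le\mathrm{poly}(1/\varepsilon)$.
   Context: A $p$-group is a (finite Abelian) group in which every element has order a power of $p$. $\mathcal{P}_1(\{0,1\}^n,G)$ is the set of functions $P(x)=a_0+\sum_{i=1}^n a_ix_i$, $a_i\in G$, $x\in\{0,1\}^n$. $\delta(f,P)=\Pr_{x\sim\{0,1\}^n}[f(x)\ne P(x)]$ and $\mathsf{List}^f_\varepsilon=\{P\in\mathcal{P}_1(\{0,1\}^n,G):\delta(f,P)\le 1/2-\varepsilon\}$. The polynomial bound is independent of $n$, $f$ and $G$. -}

module Defs where

open import Level using (0ℓ)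
open import Algebra.Bundles using (AbelianGroup)
import Algebra.Construct.DirectProduct as DP
import Algebra.Construct.Terminal as Term
open import Data.Bool using (Bool; true; false; if_then_else_)
open import Data.Nat as ℕ using (ℕ; zero; suc; _^_; _≤_)
open import Data.Nat.Properties using (m^n≢0)
open import Data.Nat.Primality using (Prime)
open import Data.Integer using (+_)
open import Data.Rational as ℚ using (ℚ; _-_; _*_; 1ℚ)
open import Data.Product using (Σ; ∃; _×_; _,_; proj₁; proj₂)
open import Data.List using (List; []; _∷_; map; concatMap; length; filter)
open import Data.List.Relation.Unary.Any using (Any)
open import Data.Vec using (Vec; []; _∷_)
open import Data.Unit using (tt)
open import Relation.Nullary using (Dec; yes; no; ¬_)
open import Relation.Nullary.Decidable using (_×-dec_)
open import Relation.Binary using (Decidable)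

record FinAbGroup : Set₁ where
  field
    group : AbelianGroup 0ℓ 0ℓ
  open AbelianGroup group public hiding (group)
  field
    _≟_      : Decidable _≈_
    elements : List Carrier
    complete : ∀ (g : Carrier) → Any (g ≈_) elements

module _ (G : AbelianGroup 0ℓ 0ℓ) where
  open AbelianGroup G
  times : ℕ → Carrier → Carrier
  times zero    g = ε
  times (suc k) g = g ∙ times k g

record PGroupFactor : Set₁ where
  field
    fin     : FinAbGroup
    p       : ℕ
    p-prime : Prime p
    p≥5     : 5 ≤ p
  open FinAbGroup fin
  field
    p-power : ∀ (g : Carrier) → ∃ λ k → times group (p ^ k) g ≈ ε

trivialFin : FinAbGroup
trivialFin = record
  { group = Term.abelianGroup {0ℓ} {0ℓ}
  ; _≟_ = λ _ _ → yes _
  ; elements = _ ∷ []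
  ; complete = λ _ → Any.here _
  }

productFin : FinAbGroup → FinAbGroup → FinAbGroup
productFin A B = record
  { group = DP.abelianGroup (FinAbGroup.group A) (FinAbGroup.group B)
  ; _≟_ = λ { (a , b) (a' , b') → (FinAbGroup._≟_ A a a') ×-dec (FinAbGroup._≟_ B b b') }
  ; elements = concatMap (λ a → map (a ,_) (FinAbGroup.elements B)) (FinAbGroup.elements A)
  ; complete = λ { (a , b) → lemma a b }
  }
  where
  open import Data.List.Relation.Unary.Any.Properties using (concat⁺; map⁺)
  open import Data.List.Relation.Unary.Any using (here; there)
  import Data.List.Relation.Unary.Any as Any
  open import Data.Product.Relation.Binary.Pointwise.NonDependent using (Pointwise)
  lemma : ∀ a b → Any (λ y → Pointwise (FinAbGroup._≈_ A) (FinAbGroup._≈_ B) (a , b) y)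
                  (concatMap (λ a → map (a ,_) (FinAbGroup.elements B)) (FinAbGroup.elements A))
  lemma a b = concat⁺ (map⁺ (Any.map (λ {x} a≈x → map⁺ (Any.map (λ b≈y → a≈x , b≈y) (FinAbGroup.complete B b))) (FinAbGroup.complete A a)))

prodFactors : List PGroupFactor → FinAbGroup
prodFactors []       = trivialFin
prodFactors (F ∷ Fs) = productFin (PGroupFactor.fin F) (prodFactors Fs)

cube : (n : ℕ) → List (Vec Bool n)
cube zero    = [] ∷ []
cube (suc n) = concatMap (λ b → map (b ∷_) (cube n)) (true ∷ false ∷ [])

module Poly (G : FinAbGroup) where
  open FinAbGroup G

  -- degree ≤ 1 polynomial  a₀ + Σ aᵢ xᵢ, given by its coefficients
  Coeffs : ℕ → Set
  Coeffs n = Carrier × Vec Carrier n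

  linSum : ∀ {n} → Vec Carrier n → Vec Bool n → Carrier
  linSum []       []       = ε
  linSum (a ∷ as) (x ∷ xs) = (if x then a else ε) ∙ linSum as xs

  eval : ∀ {n} → Coeffs n → Vec Bool n → Carrier
  eval (a₀ , as) x = a₀ ∙ linSum as x

  disagree : ∀ {n} → (Vec Bool n → Carrier) → Coeffs n → ℕ
  disagree {n} f P = length (filter (λ x → Relation.Nullary.¬? (f x ≟ eval P x)) (cube n))
    where import Relation.Nullary

  δ : ∀ {n} → (Vec Bool n → Carrier) → Coeffs n → ℚ
  δ {n} f P = ((+ disagree f P) ℚ./ (2 ^ n)) {{m^n≢0 2 n}}

  InList : ∀ {n} → (Vec Bool n → Carrier) → ℚ → Coeffs n → Set
  InList f ε' P = δ f P ℚ.≤ (ℚ.½ ℚ.- ε')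

  DistinctFn : ∀ {n} → Coeffs n → Coeffs n → Set
  DistinctFn {n} P Q = ¬ (∀ (x : Vec Bool n) → eval P x ≈ eval Q x)

_^ℚ_ : ℚ → ℕ → ℚ
q ^ℚ zero  = 1ℚ
q ^ℚ suc k = q * (q ^ℚ k)

-- Put m ≈ 1/ε. The argument has three parts.
--
-- (1) Anticoncentration. In G the multiples 0, a, 2a, 3a, 4a of any a ≠ 0 are distinct. If D is a
-- multiset of group elements with collision density 1/5 + u, then D ∪ (D + a) has collision density
-- at most 1/5 + 3u/4: compare D with its shifts by a and 2a, using the nonnegativity of the sum of
-- squared second differences. Hence ten nonzero coefficients bring the collision density down to
-- 1/4, and twenty make every value of a linear polynomial have probability at most 1/4.
--
-- (2) The agreement sets have density at least 1/2 + 1/m, so on average two of them meet in density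
-- more than 1/4 + 1/m. By (1) the polynomials meeting so often differ in fewer than twenty
-- coefficients, so a 1/m fraction of the list lies near a single polynomial; translate it to 0.
--
-- (3) Polynomials with few nonzero coefficients. For nonconstant P each value has probability at most
-- 1/2, so if the list agrees with f noticeably more often then the number of P with P(x) = v has
-- large variance, summed over v. Polynomials with disjoint supports are independent, so many pairs
-- share a variable and some variable occurs in many polynomials. Fixing it lowers the number of
-- nonzero coefficients, and polynomials that become equal can be counted by their disjoint agreement
-- sets on the other half of the cube.

{-# OPTIONS --safe #-}
module Submission where

open import Defs
open import Level using (0ℓ)
open import Algebra.Bundles using (AbelianGroup; CommutativeMonoid)
import Algebra.Properties.AbelianGroup as AbelianGroupProperties
import Algebra.Properties.CommutativeSemigroup as CommutativeSemigroupProperties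
import Algebra.Properties.Monoid.Mult as Mult
open import Data.Bool using (Bool; true; false; not; if_then_else_)
open import Data.Fin using (Fin; zero; suc)
import Data.Fin.Properties as Fin
open import Data.Integer as ℤ using (ℤ; +_; 0ℤ; 1ℤ; +≤+)
import Data.Integer.Properties as ℤ
open import Data.Integer.Tactic.RingSolver using (solve-∀)
open import Data.List using (List; []; _∷_; map; length; filter; _++_; deduplicate)
open import Data.List.Properties using (length-++; length-map)
import Data.List.Membership.Setoid.Properties as Membership
open import Data.List.Relation.Unary.All as All using (All; []; _∷_)
import Data.List.Relation.Unary.All.Properties as All
open import Data.List.Relation.Unary.AllPairs as AllPairs using (AllPairs; []; _∷_)
import Data.List.Relation.Unary.AllPairs.Properties as AllPairs
open import Data.List.Relation.Unary.Any as Any using (Any; here; there)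
open import Data.List.Relation.Unary.Unique.DecSetoid.Properties using (deduplicate-!)
open import Data.Nat as ℕ using (ℕ; zero; suc; s≤s; z≤n)
open import Data.Nat.Coprimality as Coprimality using (Coprime; coprime-Bézout; prime⇒coprime)
import Data.Nat.DivMod as ℕ
open import Data.Nat.GCD using (module Bézout)
import Data.Nat.Properties as ℕ
open import Data.Product using (Σ; ∃; _×_; _,_; proj₁; proj₂)
open import Data.Rational as ℚ using (ℚ; mkℚ; Positive; _/_; 1/_)
import Data.Rational.Properties as ℚ
open import Data.Rational.Properties using (pos⇒nonZero)
open import Data.Rational.Unnormalised as ℚᵘ using (mkℚᵘ; *≤*; *≡*)
import Data.Rational.Unnormalised.Properties as ℚᵘ
open import Data.Sum using (_⊎_; inj₁; inj₂)
open import Data.Vec using (Vec; []; _∷_; lookup; zipWith; _[_]≔_)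
open import Data.Vec.Properties using (lookup∘update′)
open import Relation.Binary using (DecSetoid)
open import Relation.Binary.PropositionalEquality using (_≡_; refl; sym; trans; cong; cong₂; subst; subst₂; module ≡-Reasoning)
open import Relation.Nullary using (Dec; yes; no; ¬_; ¬?; contradiction)
open import Relation.Nullary.Decidable using (from-yes; _×-dec_)
open import Relation.Unary using (Pred) renaming (Decidable to Decidable₁)

-- Torsion in products of p-groups with p at least 5.

-- The primes enter the counting only through this property: as the multiples 1 to 4 of a nonzero
-- element never vanish, its multiples 0 to 4 are pairwise distinct.
TorsionFree : FinAbGroup → Set
TorsionFree G = ∀ k a → k ℕ.< 4 → times group (suc k) a ≈ ε → a ≈ ε
  where open FinAbGroup G

module Torsion (G : AbelianGroup 0ℓ 0ℓ) where
  open AbelianGroup G renaming (refl to ≈-refl; sym to ≈-sym; trans to ≈-trans; reflexive to ≈-reflexive)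
  open Mult monoid renaming (_×_ to _·_)

  times≡· : ∀ k g → times G k g ≡ k · g
  times≡· zero    g = refl
  times≡· (suc k) g = cong (g ∙_) (times≡· k g)

  ·-ε : ∀ k → k · ε ≈ ε
  ·-ε zero    = ≈-refl
  ·-ε (suc k) = ≈-trans (identityˡ _) (·-ε k)

  multiple≈ε : ∀ x j {b} → j · b ≈ ε → (x ℕ.* j) · b ≈ ε
  multiple≈ε x j {b} e = ≈-trans (≈-sym (×-assocˡ b x j)) (≈-trans (×-congʳ x e) (·-ε x))

  -- Bézout writes 1 as the difference of a multiple of `i` and a multiple of `j`, in one of two
  -- orders, and both multiples kill `b`.
  coprime-torsion : ∀ {i j b} → Coprime i j → i · b ≈ ε → j · b ≈ ε → b ≈ ε
  coprime-torsion {i} {j} {b} coprime ib jb with coprime-Bézout coprime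
  ... | Bézout.+- x y eq = ≈-trans (≈-sym (identityʳ b)) (≈-trans (∙-congˡ (≈-sym (multiple≈ε y j jb)))
          (≈-trans (≈-reflexive (cong (_· b) eq)) (multiple≈ε x i ib)))
  ... | Bézout.-+ x y eq = ≈-trans (≈-sym (identityʳ b)) (≈-trans (∙-congˡ (≈-sym (multiple≈ε x i ib)))
          (≈-trans (≈-reflexive (cong (_· b) eq)) (multiple≈ε y j jb)))

  -- By induction `p · b` vanishes, being killed by `p ^ k` and by `j`; then `b` itself is killed by
  -- the coprime numbers `p` and `j`.
  prime-power-torsion : ∀ {p j} → Coprime p j → ∀ k b → (p ℕ.^ k) · b ≈ ε → j · b ≈ ε → b ≈ ε
  prime-power-torsion coprime zero    b pb jb = ≈-trans (≈-sym (identityʳ b)) pb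
  prime-power-torsion {p} {j} coprime (suc k) b pb jb = coprime-torsion coprime
    (prime-power-torsion coprime k (p · b)
      (≈-trans (×-assocˡ b (p ℕ.^ k) p) (≈-trans (≈-reflexive (cong (_· b) (ℕ.*-comm (p ℕ.^ k) p))) pb))
      (≈-trans (×-assocˡ b j p) (≈-trans (≈-reflexive (cong (_· b) (ℕ.*-comm j p))) (multiple≈ε p j jb))))
    jb

factor-torsionFree : ∀ F → TorsionFree (PGroupFactor.fin F)
factor-torsionFree F k a k<4 e =
  -- `suc k` is at most 4, hence smaller than the prime `p` and coprime to it.
  prime-power-torsion (prime⇒coprime p-prime (ℕ.<-≤-trans (s≤s k<4) p≥5)) (proj₁ (p-power a)) a
    (subst (λ g → FinAbGroup._≈_ fin g (FinAbGroup.ε fin)) (times≡· (p ℕ.^ proj₁ (p-power a)) a) (proj₂ (p-power a)))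
    (subst (λ g → FinAbGroup._≈_ fin g (FinAbGroup.ε fin)) (times≡· (suc k) a) e)
  where
  open PGroupFactor F
  open Torsion (FinAbGroup.group fin)

times-product : ∀ A B k a b → times (FinAbGroup.group (productFin A B)) k (a , b) ≡
                              (times (FinAbGroup.group A) k a , times (FinAbGroup.group B) k b)
times-product A B zero    a b = refl
times-product A B (suc k) a b = cong (FinAbGroup._∙_ (productFin A B) (a , b)) (times-product A B k a b)

product-torsionFree : ∀ A B → TorsionFree A → TorsionFree B → TorsionFree (productFin A B)
product-torsionFree A B tA tB k (a , b) k<4 e = tA k a k<4 (proj₁ e') , tB k b k<4 (proj₂ e')
  where
  e' = subst (λ g → FinAbGroup._≈_ (productFin A B) g (FinAbGroup.ε (productFin A B))) (times-product A B (suc k) a b) e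

torsionFree : ∀ Fs → TorsionFree (prodFactors Fs)
torsionFree []       k a k<4 e = _
torsionFree (F ∷ Fs) = product-torsionFree (PGroupFactor.fin F) (prodFactors Fs) (factor-torsionFree F) (torsionFree Fs)

-- Integer inequalities and finite sums of indicators.

module Counting where
  open import Data.Integer using (_+_; _*_; _-_; _≤_; _^_)

  -- Most inequalities below are certified by an explicit nonnegative slack: the ring solver checks
  -- the identity, while `gap`, `_⊕_` and `_⊗_` assemble the sign of the slack.
  ≤-by : ∀ {a b} c → 0ℤ ≤ c → b ≡ a + c → a ≤ b
  ≤-by {a} c 0≤c refl = subst (_≤ a + c) (ℤ.+-identityʳ a) (ℤ.+-monoʳ-≤ a 0≤c)

  gap : ∀ {a b} → a ≤ b → 0ℤ ≤ b - a
  gap = ℤ.i≤j⇒0≤j-i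

  infixl 6 _⊕_
  infixl 7 _⊗_

  _⊕_ : ∀ {a b} → 0ℤ ≤ a → 0ℤ ≤ b → 0ℤ ≤ a + b
  _⊕_ = ℤ.+-mono-≤

  _⊗_ : ∀ {a b} → 0ℤ ≤ a → 0ℤ ≤ b → 0ℤ ≤ a * b
  +≤+ {n = m} _ ⊗ +≤+ {n = n} _ = subst (0ℤ ≤_) (ℤ.pos-* m n) (+≤+ ℕ.z≤n)

  0≤+ : ∀ n → 0ℤ ≤ + n
  0≤+ n = +≤+ ℕ.z≤n

  0≤square : ∀ a → 0ℤ ≤ a * a
  0≤square (+ n) = 0≤+ n ⊗ 0≤+ n
  0≤square (ℤ.-[1+ n ]) = +≤+ ℕ.z≤n

  cancel-≤ : ∀ {a b} k .{{_ : ℤ.Positive k}} → k * a ≤ k * b → a ≤ b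
  cancel-≤ {a} {b} k = ℤ.*-cancelˡ-≤-pos a b k

  square-mono : ∀ {a b} → 0ℤ ≤ a → a ≤ b → a * a ≤ b * b
  square-mono {a} {b} 0≤a a≤b =
    ≤-by ((b - a) * (b - a) + (a + a) * (b - a)) (0≤square (b - a) ⊕ (0≤a ⊕ 0≤a) ⊗ gap a≤b) (identity a b)
    where
    identity : ∀ a b → b * b ≡ a * a + ((b - a) * (b - a) + (a + a) * (b - a))
    identity = solve-∀

  +-congʳ : ∀ a {b c} → b ≡ c → a + b ≡ a + c
  +-congʳ a refl = refl

  private variable
    A B : Set

  ind : Dec A → ℤ
  ind (yes _) = 1ℤ
  ind (no _)  = 0ℤ

  0≤ind : (d : Dec A) → 0ℤ ≤ ind d
  0≤ind (yes _) = 0≤+ 1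
  0≤ind (no _)  = 0≤+ 0

  ind≤1 : (d : Dec A) → ind d ≤ 1ℤ
  ind≤1 (yes _) = ℤ.≤-refl
  ind≤1 (no _)  = 0≤+ 1

  ind-mono : (d : Dec A) (e : Dec B) → (A → B) → ind d ≤ ind e
  ind-mono (yes _) (yes _) f = ℤ.≤-refl
  ind-mono (yes a) (no ¬b) f = contradiction (f a) ¬b
  ind-mono (no _)  e       f = 0≤ind e

  ind-cong : (d : Dec A) (e : Dec B) → (A → B) → (B → A) → ind d ≡ ind e
  ind-cong d e f g = ℤ.≤-antisym (ind-mono d e f) (ind-mono e d g)

  ind-yes : (d : Dec A) → A → ind d ≡ 1ℤ
  ind-yes (yes _) a = refl
  ind-yes (no ¬a) a = contradiction a ¬a

  ind-no : (d : Dec A) → ¬ A → ind d ≡ 0ℤ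
  ind-no (yes a) ¬a = contradiction a ¬a
  ind-no (no _)  ¬a = refl

  ∑ : List A → (A → ℤ) → ℤ
  ∑ []       f = 0ℤ
  ∑ (x ∷ xs) f = f x + ∑ xs f

  ∣_∣ : List A → ℤ
  ∣ xs ∣ = + length xs

  ∑-cong : ∀ (xs : List A) {f g : A → ℤ} → (∀ x → f x ≡ g x) → ∑ xs f ≡ ∑ xs g
  ∑-cong []       e = refl
  ∑-cong (x ∷ xs) e = cong₂ _+_ (e x) (∑-cong xs e)

  ∑-mono-All : ∀ {xs : List A} {f g : A → ℤ} → All (λ x → f x ≤ g x) xs → ∑ xs f ≤ ∑ xs g
  ∑-mono-All []       = ℤ.≤-refl
  ∑-mono-All (p ∷ ps) = ℤ.+-mono-≤ p (∑-mono-All ps)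

  ∑-mono : ∀ (xs : List A) {f g : A → ℤ} → (∀ x → f x ≤ g x) → ∑ xs f ≤ ∑ xs g
  ∑-mono xs e = ∑-mono-All (All.universal e xs)

  ∑-nonneg : ∀ (xs : List A) {f : A → ℤ} → (∀ x → 0ℤ ≤ f x) → 0ℤ ≤ ∑ xs f
  ∑-nonneg []       e = ℤ.≤-refl
  ∑-nonneg (x ∷ xs) e = e x ⊕ ∑-nonneg xs e

  ∑-+ : ∀ (xs : List A) (f g : A → ℤ) → ∑ xs (λ x → f x + g x) ≡ ∑ xs f + ∑ xs g
  ∑-+ []       f g = refl
  ∑-+ (x ∷ xs) f g = trans (+-congʳ (f x + g x) (∑-+ xs f g)) (identity (f x) (g x) _ _)
    where
    identity : ∀ a b c d → a + b + (c + d) ≡ a + c + (b + d)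
    identity = solve-∀

  ∑-* : ∀ (xs : List A) c (f : A → ℤ) → ∑ xs (λ x → c * f x) ≡ c * ∑ xs f
  ∑-* []       c f = sym (ℤ.*-zeroʳ c)
  ∑-* (x ∷ xs) c f = trans (+-congʳ (c * f x) (∑-* xs c f)) (sym (ℤ.*-distribˡ-+ c (f x) _))

  ∑-*ʳ : ∀ (xs : List A) c (f : A → ℤ) → ∑ xs (λ x → f x * c) ≡ ∑ xs f * c
  ∑-*ʳ xs c f = trans (∑-cong xs (λ x → ℤ.*-comm (f x) c)) (trans (∑-* xs c f) (ℤ.*-comm c _))

  ∑-const : ∀ (xs : List A) c → ∑ xs (λ _ → c) ≡ ∣ xs ∣ * c
  ∑-const []       c = refl
  ∑-const (x ∷ xs) c = trans (+-congʳ c (∑-const xs c)) (identity c ∣ xs ∣)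
    where
    identity : ∀ c l → c + l * c ≡ (1ℤ + l) * c
    identity = solve-∀

  ∑-zero : ∀ (xs : List A) → ∑ xs (λ _ → 0ℤ) ≡ 0ℤ
  ∑-zero []       = refl
  ∑-zero (x ∷ xs) = trans (ℤ.+-identityˡ _) (∑-zero xs)

  ∑-swap : ∀ (xs : List A) (ys : List B) (f : A → B → ℤ) →
           ∑ xs (λ x → ∑ ys (f x)) ≡ ∑ ys (λ y → ∑ xs (λ x → f x y))
  ∑-swap []       ys f = sym (∑-zero ys)
  ∑-swap (x ∷ xs) ys f = trans (+-congʳ (∑ ys (f x)) (∑-swap xs ys f)) (sym (∑-+ ys (f x) _))

  ∑-++ : ∀ (xs ys : List A) (f : A → ℤ) → ∑ (xs ++ ys) f ≡ ∑ xs f + ∑ ys f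
  ∑-++ []       ys f = sym (ℤ.+-identityˡ _)
  ∑-++ (x ∷ xs) ys f = trans (+-congʳ (f x) (∑-++ xs ys f)) (sym (ℤ.+-assoc (f x) _ _))

  ∑-map : ∀ (h : A → B) (xs : List A) (f : B → ℤ) → ∑ (map h xs) f ≡ ∑ xs (λ x → f (h x))
  ∑-map h []       f = refl
  ∑-map h (x ∷ xs) f = +-congʳ (f (h x)) (∑-map h xs f)

  ∑-product : ∀ (xs : List A) (ys : List B) (f : A → ℤ) (g : B → ℤ) →
              ∑ xs f * ∑ ys g ≡ ∑ xs (λ x → ∑ ys (λ y → f x * g y))
  ∑-product xs ys f g = trans (sym (∑-*ʳ xs (∑ ys g) f)) (∑-cong xs (λ x → sym (∑-* ys (f x) g)))

  ∑-filter : ∀ {P : Pred A _} (P? : Decidable₁ P) (xs : List A) (f : A → ℤ) →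
             ∑ (filter P? xs) f ≡ ∑ xs (λ x → ind (P? x) * f x)
  ∑-filter P? []       f = refl
  ∑-filter P? (x ∷ xs) f with P? x
  ... | yes _ = cong₂ _+_ (sym (ℤ.*-identityˡ (f x))) (∑-filter P? xs f)
  ... | no _  = trans (∑-filter P? xs f) (sym (ℤ.+-identityˡ _))

  ∣_∣≡∑1 : ∀ (xs : List A) → ∣ xs ∣ ≡ ∑ xs (λ _ → 1ℤ)
  ∣ xs ∣≡∑1 = sym (trans (∑-const xs 1ℤ) (ℤ.*-identityʳ _))

  ∣filter∣ : ∀ {P : Pred A _} (P? : Decidable₁ P) (xs : List A) → ∣ filter P? xs ∣ ≡ ∑ xs (λ x → ind (P? x))
  ∣filter∣ P? xs = trans (∣ filter P? xs ∣≡∑1) (trans (∑-filter P? xs _) (∑-cong xs (λ x → ℤ.*-identityʳ _)))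

  -- Adding an entry with value `a` raises the difference of the two sides by exactly the sum of the
  -- squares of `u y - a` over the other entries.
  ∑-cauchy : ∀ (xs : List A) (u : A → ℤ) → ∑ xs u * ∑ xs u ≤ ∣ xs ∣ * ∑ xs (λ x → u x * u x)
  ∑-cauchy []       u = ℤ.≤-refl
  ∑-cauchy (x ∷ xs) u = ≤-by ((N * Q - S * S) + ∑ xs (λ y → (u y - a) * (u y - a)))
    (gap (∑-cauchy xs u) ⊕ ∑-nonneg xs (λ y → 0≤square (u y - a)))
    (trans (identity a N S Q) (cong (λ z → (a + S) * (a + S) + (N * Q - S * S + z)) (sym expand)))
    where
    a = u x
    N = ∣ xs ∣
    S = ∑ xs u
    Q = ∑ xs (λ y → u y * u y)
    pointwise : ∀ b a → (b - a) * (b - a) ≡ b * b + ((ℤ.- (a + a)) * b + a * a)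
    pointwise = solve-∀
    identity : ∀ a N S Q → (1ℤ + N) * (a * a + Q) ≡ (a + S) * (a + S) + (N * Q - S * S + (Q + ((ℤ.- (a + a)) * S + N * (a * a))))
    identity = solve-∀
    expand : ∑ xs (λ y → (u y - a) * (u y - a)) ≡ Q + ((ℤ.- (a + a)) * S + N * (a * a))
    expand = trans (∑-cong xs (λ y → pointwise (u y) a))
      (trans (∑-+ xs (λ y → u y * u y) (λ y → (ℤ.- (a + a)) * u y + a * a))
        (+-congʳ Q (trans (∑-+ xs (λ y → (ℤ.- (a + a)) * u y) (λ _ → a * a))
          (cong₂ _+_ (∑-* xs (ℤ.- (a + a)) u) (∑-const xs (a * a))))))

  ∑-exclusive : ∀ {P : Pred A _} (P? : Decidable₁ P) {xs : List A} →
                AllPairs (λ x y → P x → ¬ P y) xs → ∑ xs (λ x → ind (P? x)) ≤ 1ℤ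
  ∑-exclusive P? []       = 0≤+ 1
  ∑-exclusive P? {x ∷ xs} (p ∷ ps) with P? x
  ... | no _   = subst (_≤ 1ℤ) (sym (ℤ.+-identityˡ _)) (∑-exclusive P? ps)
  ... | yes px = ℤ.≤-reflexive (+-congʳ 1ℤ (none p))
    where
    none : ∀ {ys} → All (λ y → _ → ¬ _) ys → ∑ ys (λ y → ind (P? y)) ≡ 0ℤ
    none []       = refl
    none {y ∷ ys} (q ∷ qs) = cong₂ _+_ (ind-no (P? y) (q px)) (none qs)

  ∑-witness : ∀ {P : Pred A _} (P? : Decidable₁ P) {xs : List A} → Any P xs → 1ℤ ≤ ∑ xs (λ x → ind (P? x))
  ∑-witness P? {x ∷ xs} (here px) =
    ≤-by _ (∑-nonneg xs (λ y → 0≤ind (P? y))) (cong (_+ ∑ xs (λ y → ind (P? y))) (ind-yes (P? x) px))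
  ∑-witness P? {x ∷ xs} (there p) = ℤ.≤-trans (∑-witness P? p) (≤-by _ (0≤ind (P? x)) (ℤ.+-comm (ind (P? x)) _))

  -- Sums over the cube and two averaging arguments.

  ∑-cube : ∀ n (F : Vec Bool (suc n) → ℤ) →
           ∑ (cube (suc n)) F ≡ ∑ (cube n) (λ x → F (true ∷ x)) + ∑ (cube n) (λ x → F (false ∷ x))
  ∑-cube n F =
    trans (∑-++ (map (true ∷_) (cube n)) _ F)
      (cong₂ _+_ (∑-map (true ∷_) (cube n) F)
        (trans (∑-++ (map (false ∷_) (cube n)) [] F)
          (trans (ℤ.+-identityʳ _) (∑-map (false ∷_) (cube n) F))))

  2^ : ℕ → ℤ
  2^ n = + (2 ℕ.^ n)

  2^suc : ∀ n → 2^ (suc n) ≡ 2^ n + 2^ n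
  2^suc n = cong +_ (cong (2 ℕ.^ n ℕ.+_) (ℕ.+-identityʳ (2 ℕ.^ n)))

  ∑-cube-1 : ∀ n → ∑ (cube n) (λ _ → 1ℤ) ≡ 2^ n
  ∑-cube-1 zero    = refl
  ∑-cube-1 (suc n) = trans (∑-cube n (λ _ → 1ℤ)) (trans (cong₂ _+_ (∑-cube-1 n) (∑-cube-1 n)) (sym (2^suc n)))

  ∣cube∣ : ∀ n → ∣ cube n ∣ ≡ 2^ n
  ∣cube∣ n = trans ∣ cube n ∣≡∑1 (∑-cube-1 n)

  2^-positive : ∀ n → ℤ.Positive (2^ n)
  2^-positive n = ℤ.positive (ℤ.+<+ (ℕ.m^n>0 2 n))

  0≤2^ : ∀ n → 0ℤ ≤ 2^ n
  0≤2^ n = 0≤+ (2 ℕ.^ n)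

  coordinates : ∀ n → List (Fin n)
  coordinates zero    = []
  coordinates (suc n) = zero ∷ map suc (coordinates n)

  ∑-coordinates : ∀ n (F : Fin (suc n) → ℤ) → ∑ (coordinates (suc n)) F ≡ F zero + ∑ (coordinates n) (λ k → F (suc k))
  ∑-coordinates n F = +-congʳ (F zero) (∑-map suc (coordinates n) F)

  0≤^ : ∀ b m → 0ℤ ≤ (+ b) ^ m
  0≤^ b zero    = 0≤+ 1
  0≤^ b (suc m) = 0≤+ b ⊗ 0≤^ b m

  *-positive : ∀ i j → ℤ.Positive i → ℤ.Positive j → ℤ.Positive (i * j)
  *-positive (+ suc i) (+ suc j) _ _ = _

  4^-positive : ∀ m → ℤ.Positive ((+ 4) ^ m)
  4^-positive zero    = _
  4^-positive (suc m) = *-positive (+ 4) ((+ 4) ^ m) _ (4^-positive m)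

  pigeonhole : ∀ (x : A) (xs : List A) (g : A → ℤ) c → ∣ x ∷ xs ∣ * c ≤ ∑ (x ∷ xs) g → Any (λ y → c ≤ g y) (x ∷ xs)
  pigeonhole x xs g c h with c ℤ.≤? g x
  ... | yes c≤gx = here c≤gx
  pigeonhole x []       g c h | no c≰gx =
    contradiction (subst₂ _≤_ (ℤ.*-identityˡ c) (ℤ.+-identityʳ (g x)) h) c≰gx
  pigeonhole x (y ∷ ys) g c h | no c≰gx = there (pigeonhole y ys g c
    (≤-by _ (gap h ⊕ gap (ℤ.<⇒≤ (ℤ.≰⇒> c≰gx))) (rearrange (g x) (∑ (y ∷ ys) g) c ∣ y ∷ ys ∣)))
    where
    rearrange : ∀ a s c l → s ≡ l * c + ((a + s - (1ℤ + l) * c) + (c - a))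
    rearrange = solve-∀

  -- Setting coordinate `k` to `b` hits every point of that face exactly twice, so the two faces
  -- together count each point twice. Faces can thus be treated as functions on the whole cube,
  -- without changing `n`.
  ∑-update : ∀ {n} (k : Fin n) (F : Vec Bool n → ℤ) →
             ∑ (cube n) (λ x → F (x [ k ]≔ true)) + ∑ (cube n) (λ x → F (x [ k ]≔ false)) ≡ ∑ (cube n) F + ∑ (cube n) F
  ∑-update {suc n} zero F = begin
    ∑ (cube (suc n)) (λ x → F (x [ zero ]≔ true)) + ∑ (cube (suc n)) (λ x → F (x [ zero ]≔ false))
      ≡⟨ cong₂ _+_ (∑-cube n (λ x → F (x [ zero ]≔ true))) (∑-cube n (λ x → F (x [ zero ]≔ false))) ⟩
    (T + T) + (U + U)
      ≡⟨ identity T U ⟩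
    (T + U) + (T + U)
      ≡⟨ cong (λ z → z + z) (sym (∑-cube n F)) ⟩
    ∑ (cube (suc n)) F + ∑ (cube (suc n)) F ∎
    where
    open ≡-Reasoning
    T = ∑ (cube n) (λ x → F (true ∷ x))
    U = ∑ (cube n) (λ x → F (false ∷ x))
    identity : ∀ T U → (T + T) + (U + U) ≡ (T + U) + (T + U)
    identity = solve-∀
  ∑-update {suc n} (suc k) F = begin
    ∑ (cube (suc n)) (λ x → F (x [ suc k ]≔ true)) + ∑ (cube (suc n)) (λ x → F (x [ suc k ]≔ false))
      ≡⟨ cong₂ _+_ (∑-cube n (λ x → F (x [ suc k ]≔ true))) (∑-cube n (λ x → F (x [ suc k ]≔ false))) ⟩
    (S true true + S false true) + (S true false + S false false)
      ≡⟨ identity (S true true) (S false true) (S true false) (S false false) ⟩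
    (S true true + S true false) + (S false true + S false false)
      ≡⟨ cong₂ _+_ (∑-update k (λ x → F (true ∷ x))) (∑-update k (λ x → F (false ∷ x))) ⟩
    (T true + T true) + (T false + T false)
      ≡⟨ identity (T true) (T true) (T false) (T false) ⟩
    (T true + T false) + (T true + T false)
      ≡⟨ cong (λ z → z + z) (sym (∑-cube n F)) ⟩
    ∑ (cube (suc n)) F + ∑ (cube (suc n)) F ∎
    where
    open ≡-Reasoning
    S : Bool → Bool → ℤ
    S y b = ∑ (cube n) (λ x → F (y ∷ (x [ k ]≔ b)))
    T : Bool → ℤ
    T y = ∑ (cube n) (λ x → F (y ∷ x))
    identity : ∀ p q r s → (p + q) + (r + s) ≡ (p + r) + (q + s)
    identity = solve-∀

  -- Were every `T x` too small, integrality would give `(w * W) * T x ≤ L - 1`. Multiplying by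
  -- `T x` and summing yields `w * L * L ≤ (L - 1) * (w * L)`, which fails for positive `L`.
  popular : ∀ (xs : List A) (T : A → ℤ) L W w .{{_ : ℤ.Positive L}} .{{_ : ℤ.Positive w}} → (∀ x → 0ℤ ≤ T x) →
            L * L ≤ W * ∑ xs (λ x → T x * T x) → ∑ xs T ≤ w * L → Any (λ x → L ≤ (w * W) * T x) xs
  popular xs T L@(+ suc _) W w@(+ suc w') 0≤T squares total with Any.any? (λ x → L ℤ.≤? ((w * W) * T x)) xs
  ... | yes p = p
  ... | no ¬p = contradiction L≤0 λ { (+≤+ ()) }
    where
    Q = ∑ xs (λ x → T x * T x)
    small : All (λ x → (w * W) * (T x * T x) ≤ (L - 1ℤ) * T x) xs
    small = All.map (λ {x} ¬q → ≤-by _ (gap (ℤ.i<j⇒suc[i]≤j (ℤ.≰⇒> ¬q)) ⊗ 0≤T x) (identity (w * W) (T x) L)) (All.¬Any⇒All¬ xs ¬p)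
      where
      identity : ∀ c t L → (L - 1ℤ) * t ≡ c * (t * t) + (L - (1ℤ + c * t)) * t
      identity = solve-∀
    summed : (w * W) * Q ≤ (L - 1ℤ) * ∑ xs T
    summed = subst₂ _≤_ (∑-* xs (w * W) (λ x → T x * T x)) (∑-* xs (L - 1ℤ) T) (∑-mono-All small)
    L≤0 : L ≤ 0ℤ
    L≤0 = cancel-≤ w (≤-by _ ((0≤+ (suc w') ⊗ gap squares ⊕ gap summed) ⊕ gap 1≤L ⊗ gap total) (identity w L W Q (∑ xs T)))
      where
      1≤L : 1ℤ ≤ L
      1≤L = +≤+ (s≤s z≤n)
      identity : ∀ w L W Q S → w * 0ℤ ≡ w * L + ((w * (W * Q - L * L) + ((L - 1ℤ) * S - (w * W) * Q)) + (L - 1ℤ) * (w * L - S))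
      identity = solve-∀

  -- The numerical bound for sparse polynomials.

  -- The leading 1 counts constants. In the recursive factor, `suc w` and two factors `M` are the
  -- cost of passing to a popular variable, 2 counts its two faces, and the third `M` is the growth
  -- of the multiplicity under restriction.
  sparseBound : ℤ → ℕ → ℤ
  sparseBound M zero    = 1ℤ
  sparseBound M (suc w) = 1ℤ + (+ 2 * + suc w * (M * M * M)) * sparseBound M w

  0≤sparseBound : ∀ m w → 0ℤ ≤ sparseBound (+ m) w
  0≤sparseBound m zero    = 0≤+ 1
  0≤sparseBound m (suc w) = 0≤+ 1 ⊕ (0≤+ 2 ⊗ 0≤+ (suc w) ⊗ (0≤+ m ⊗ 0≤+ m ⊗ 0≤+ m)) ⊗ 0≤sparseBound m w

  ∣∣≤ : ∀ {P Q : Pred A 0ℓ} (P? : Decidable₁ P) (Q? : Decidable₁ Q) {xs : List A} →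
        All (λ x → P x ⊎ Q x) xs → ∣ xs ∣ ≤ ∣ filter P? xs ∣ + ∣ filter Q? xs ∣
  ∣∣≤ {P = P} {Q} P? Q? {xs} cover = subst₂ _≤_ (sym ∣ xs ∣≡∑1)
    (trans (∑-+ xs (λ x → ind (P? x)) (λ x → ind (Q? x))) (sym (cong₂ _+_ (∣filter∣ P? xs) (∣filter∣ Q? xs))))
    (∑-mono-All (All.map pointwise cover))
    where
    pointwise : ∀ {x} → P x ⊎ Q x → 1ℤ ≤ ind (P? x) + ind (Q? x)
    pointwise {x} (inj₁ p) = ≤-by _ (0≤ind (Q? x)) (cong (_+ ind (Q? x)) (ind-yes (P? x) p))
    pointwise {x} (inj₂ q) = ≤-by _ (0≤ind (P? x)) (trans (ℤ.+-comm (ind (P? x)) (ind (Q? x))) (cong (_+ ind (P? x)) (ind-yes (Q? x) q)))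

  nonneg : ∀ μ M W B → 0ℤ ≤ μ → 0ℤ ≤ M → 0ℤ ≤ W → 0ℤ ≤ B → 0ℤ ≤ μ * ((+ 2 * W * (M * M * M)) * B)
  nonneg μ M W B 0≤μ 0≤M 0≤W 0≤B = 0≤μ ⊗ ((0≤+ 2 ⊗ 0≤W ⊗ (0≤M ⊗ 0≤M ⊗ 0≤M)) ⊗ 0≤B)

  combine : ∀ μ M W B T L → 0ℤ ≤ M → 0ℤ ≤ W → L ≤ (W * (M * M)) * T → T ≤ + 2 * ((μ * M) * B) →
            L ≤ μ * ((+ 2 * W * (M * M * M)) * B)
  combine μ M W B T L 0≤M 0≤W L≤ T≤ =
    ≤-by (((W * (M * M)) * T - L) + (W * (M * M)) * (+ 2 * ((μ * M) * B) - T))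
      (gap L≤ ⊕ (0≤W ⊗ (0≤M ⊗ 0≤M)) ⊗ gap T≤) (identity μ M W B T L)
    where
    identity : ∀ μ M W B T L → μ * ((+ 2 * W * (M * M * M)) * B) ≡
      L + (((W * (M * M)) * T - L) + (W * (M * M)) * (+ 2 * ((μ * M) * B) - T))
    identity = solve-∀

  sparseConstant : ℕ → ℕ
  sparseConstant zero    = 1
  sparseConstant (suc w) = 1 ℕ.+ 2 ℕ.* suc w ℕ.* sparseConstant w

  1≤^ : ∀ {i} → 1ℤ ≤ i → ∀ w → 1ℤ ≤ i ^ w
  1≤^     1≤i zero    = ℤ.≤-refl
  1≤^ {i} 1≤i (suc w) = ≤-by _ (gap 1≤i ⊗ (0≤+ 1 ⊕ gap (1≤^ 1≤i w)) ⊕ gap (1≤^ 1≤i w)) (identity i (i ^ w))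
    where
    identity : ∀ i j → i * j ≡ 1ℤ + ((i - 1ℤ) * (1ℤ + (j - 1ℤ)) + (j - 1ℤ))
    identity = solve-∀

  -- Since `m` is at least 1, the 1 added in each step of the recursion is absorbed into the top
  -- power of the cube of `m`.
  sparseBound≤ : ∀ m .{{_ : ℕ.NonZero m}} w → sparseBound (+ m) w ≤ + sparseConstant w * (+ m * + m * + m) ^ w
  sparseBound≤ m zero    = ℤ.≤-refl
  sparseBound≤ m@(suc _) (suc w) = subst (λ c → sparseBound (+ m) (suc w) ≤ c * (+ m * + m * + m) ^ suc w) (sym constant≡)
      (step (+ m * + m * + m) (+ suc w) (sparseBound (+ m) w) (+ sparseConstant w) ((+ m * + m * + m) ^ w)
        (1≤^ {+ m * + m * + m} 1≤mmm (suc w)) (0≤+ m ⊗ 0≤+ m ⊗ 0≤+ m) (0≤+ (suc w)) (sparseBound≤ m w))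
    where
    1≤mmm : 1ℤ ≤ + m * + m * + m
    1≤mmm = +≤+ (s≤s z≤n)
    constant≡ : + sparseConstant (suc w) ≡ 1ℤ + + 2 * + suc w * + sparseConstant w
    constant≡ = trans (ℤ.pos-+ 1 (2 ℕ.* suc w ℕ.* sparseConstant w)) (+-congʳ 1ℤ
      (trans (ℤ.pos-* (2 ℕ.* suc w) (sparseConstant w)) (cong (_* + sparseConstant w) (ℤ.pos-* 2 (suc w)))))
    step : ∀ C W B c e → 1ℤ ≤ C * e → 0ℤ ≤ C → 0ℤ ≤ W → B ≤ c * e →
           1ℤ + (+ 2 * W * C) * B ≤ (1ℤ + + 2 * W * c) * (C * e)
    step C W B c e 1≤ 0≤C 0≤W B≤ = ≤-by _ (gap 1≤ ⊕ (0≤+ 2 ⊗ 0≤W ⊗ 0≤C) ⊗ gap B≤) (identity C W B c e)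
      where
      identity : ∀ C W B c e → (1ℤ + + 2 * W * c) * (C * e) ≡
        1ℤ + (+ 2 * W * C) * B + ((C * e - 1ℤ) + (+ 2 * W * C) * (c * e - B))
      identity = solve-∀

  pos-^ : ∀ m k → (+ m) ^ k ≡ + (m ℕ.^ k)
  pos-^ m zero    = refl
  pos-^ m (suc k) = trans (cong (+ m *_) (pos-^ m k)) (sym (ℤ.pos-* m (m ℕ.^ k)))

  -- Passage from natural numbers to rationals.

  ι : ℕ → ℚ
  ι a = (+ a) / 1

  toℚᵘ-/ : ∀ i q .{{_ : ℕ.NonZero q}} → ℚ.toℚᵘ (i / q) ℚᵘ.≃ i ℚᵘ./ q
  toℚᵘ-/ i (suc q) = ℚ.toℚᵘ-fromℚᵘ (mkℚᵘ i q)

  ι-mono : ∀ {a b} → a ℕ.≤ b → ι a ℚ.≤ ι b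
  ι-mono {a} {b} a≤b = ℚ.toℚᵘ-cancel-≤ (ℚᵘ.≤-respˡ-≃ (ℚᵘ.≃-sym (toℚᵘ-/ (+ a) 1)) (ℚᵘ.≤-respʳ-≃ (ℚᵘ.≃-sym (toℚᵘ-/ (+ b) 1))
    (*≤* (ℤ.*-monoʳ-≤-nonNeg 1ℤ (+≤+ a≤b)))))

  ι-* : ∀ a b → ι (a ℕ.* b) ≡ ι a ℚ.* ι b
  ι-* a b = ℚ.toℚᵘ-injective (ℚᵘ.≃-trans (toℚᵘ-/ (+ (a ℕ.* b)) 1) (ℚᵘ.≃-trans (*≡* (cong (_* 1ℤ) (ℤ.pos-* a b)))
    (ℚᵘ.≃-sym (ℚᵘ.≃-trans (ℚ.toℚᵘ-homo-* (ι a) (ι b)) (ℚᵘ.*-cong (toℚᵘ-/ (+ a) 1) (toℚᵘ-/ (+ b) 1))))))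

  ι-^ : ∀ a k → ι (a ℕ.^ k) ≡ ι a ^ℚ k
  ι-^ a zero    = refl
  ι-^ a (suc k) = trans (ι-* a (a ℕ.^ k)) (cong (ι a ℚ.*_) (ι-^ a k))

  ι-nonNeg : ∀ a → ℚ.NonNegative (ι a)
  ι-nonNeg a = ℚ.normalize-nonNeg a 1

  ^ℚ-nonNeg : ∀ q .{{_ : ℚ.NonNegative q}} k → ℚ.NonNegative (q ^ℚ k)
  ^ℚ-nonNeg q zero    = _
  ^ℚ-nonNeg q (suc k) = ℚ.nonNeg*nonNeg⇒nonNeg q (q ^ℚ k) {{^ℚ-nonNeg q k}}

  ^ℚ-mono : ∀ {p q} .{{_ : ℚ.NonNegative p}} .{{_ : ℚ.NonNegative q}} → p ℚ.≤ q → ∀ k → p ^ℚ k ℚ.≤ q ^ℚ k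
  ^ℚ-mono         p≤q zero    = ℚ.≤-refl
  ^ℚ-mono {p} {q} p≤q (suc k) = ℚ.≤-trans (ℚ.*-monoˡ-≤-nonNeg p (^ℚ-mono p≤q k))
    (ℚ.*-monoʳ-≤-nonNeg (q ^ℚ k) {{^ℚ-nonNeg q k}} p≤q)

  ^ℚ-distrib-* : ∀ p q k → (p ℚ.* q) ^ℚ k ≡ p ^ℚ k ℚ.* q ^ℚ k
  ^ℚ-distrib-* p q zero    = refl
  ^ℚ-distrib-* p q (suc k) = trans (cong ((p ℚ.* q) ℚ.*_) (^ℚ-distrib-* p q k)) (interchange p q (p ^ℚ k) (q ^ℚ k))
    where
    open CommutativeSemigroupProperties (CommutativeMonoid.commutativeSemigroup ℚ.*-1-commutativeMonoid) using (interchange)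

  -- The integer m standing for 1/ε is ⌊1/ε⌋ + 1.
  ceiling-≥ : ∀ d s → suc d ℕ.≤ suc (suc d ℕ./ suc s) ℕ.* suc s
  ceiling-≥ d s = ℕ.≤-trans (ℕ.≤-reflexive (ℕ.m≡m%n+[m/n]*n (suc d) (suc s)))
    (ℕ.+-monoˡ-≤ (suc d ℕ./ suc s ℕ.* suc s) (ℕ.<⇒≤ (ℕ.m%n<n (suc d) (suc s))))

  -- The hypothesis says that 1/ε is at least 1, so the 1 added to the floor is itself at most 1/ε,
  -- and the sum is at most 2/ε.
  ceiling-≤ : ∀ d s .(coprime : Coprime (suc d) (suc s)) → suc s ℕ.≤ suc d → ι (suc (suc d ℕ./ suc s)) ℚ.≤ ι 2 ℚ.* mkℚ ℤ.+[1+ d ] s coprime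
  ceiling-≤ d s coprime s≤d = ℚ.toℚᵘ-cancel-≤ (ℚᵘ.≤-respˡ-≃ (ℚᵘ.≃-sym (toℚᵘ-/ (+ m) 1))
      (ℚᵘ.≤-respʳ-≃ (ℚᵘ.≃-sym (ℚᵘ.≃-trans (ℚ.toℚᵘ-homo-* (ι 2) r) (ℚᵘ.*-congʳ {x = ℚ.toℚᵘ r} (toℚᵘ-/ (+ 2) 1))))
        (*≤* (subst₂ ℤ._≤_ lhs rhs (+≤+ bound)))))
    where
    m = suc (suc d ℕ./ suc s)
    r = mkℚ ℤ.+[1+ d ] s coprime
    bound : m ℕ.* suc s ℕ.≤ 2 ℕ.* suc d
    bound = ℕ.+-mono-≤ s≤d (ℕ.≤-trans (ℕ.m/n*n≤m (suc d) (suc s)) (ℕ.≤-reflexive (sym (ℕ.+-identityʳ (suc d)))))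
    lhs : + (m ℕ.* suc s) ≡ + m * (1ℤ * + suc s)
    lhs = trans (ℤ.pos-* m (suc s)) (cong (+ m *_) (sym (ℤ.*-identityˡ (+ suc s))))
    rhs : + (2 ℕ.* suc d) ≡ (+ 2 * + suc d) * 1ℤ
    rhs = trans (ℤ.pos-* 2 (suc d)) (sym (ℤ.*-identityʳ (+ 2 * + suc d)))

  rational-bound : ∀ C k L m r .{{_ : ℚ.NonNegative r}} → L ℕ.≤ C ℕ.* m ℕ.^ k → ι m ℚ.≤ ι 2 ℚ.* r →
                   ι L ℚ.≤ ι (C ℕ.* 2 ℕ.^ k) ℚ.* r ^ℚ k
  rational-bound C k L m r L≤ m≤ = begin
    ι L                                ≤⟨ ι-mono L≤ ⟩
    ι (C ℕ.* m ℕ.^ k)                  ≡⟨ trans (ι-* C (m ℕ.^ k)) (cong (ι C ℚ.*_) (ι-^ m k)) ⟩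
    ι C ℚ.* ι m ^ℚ k                   ≤⟨ ℚ.*-monoˡ-≤-nonNeg (ι C) {{ι-nonNeg C}}
                                            (^ℚ-mono {{ι-nonNeg m}} {{ℚ.nonNeg*nonNeg⇒nonNeg (ι 2) r}} m≤ k) ⟩
    ι C ℚ.* (ι 2 ℚ.* r) ^ℚ k           ≡⟨ cong (ι C ℚ.*_) (^ℚ-distrib-* (ι 2) r k) ⟩
    ι C ℚ.* (ι 2 ^ℚ k ℚ.* r ^ℚ k)      ≡⟨ sym (ℚ.*-assoc (ι C) (ι 2 ^ℚ k) (r ^ℚ k)) ⟩
    (ι C ℚ.* ι 2 ^ℚ k) ℚ.* r ^ℚ k      ≡⟨ cong (ℚ._* r ^ℚ k) (sym (trans (ι-* C (2 ℕ.^ k)) (cong (ι C ℚ.*_) (ι-^ 2 k)))) ⟩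
    ι (C ℕ.* 2 ℕ.^ k) ℚ.* r ^ℚ k       ∎
    where open ℚ.≤-Reasoning

  -- Equality indicators and coincidence counts in the group.

  module Polynomials (G : FinAbGroup) where
    open FinAbGroup G hiding (_-_; identity) renaming (refl to ≈-refl; sym to ≈-sym; trans to ≈-trans; reflexive to ≈-reflexive)
    open AbelianGroupProperties group
    open CommutativeSemigroupProperties commutativeSemigroup using (interchange; x∙yz≈y∙xz)
    open Poly G

    χ : Carrier → Carrier → ℤ
    χ g h = ind (g ≟ h)

    0≤χ : ∀ g h → 0ℤ ≤ χ g h
    0≤χ g h = 0≤ind (g ≟ h)

    χ≤1 : ∀ g h → χ g h ≤ 1ℤ
    χ≤1 g h = ind≤1 (g ≟ h)

    χ-cong : ∀ {g g' h h'} → g ≈ g' → h ≈ h' → χ g h ≡ χ g' h'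
    χ-cong {g} {g'} {h} {h'} p q = ind-cong (g ≟ h) (g' ≟ h')
      (λ r → ≈-trans (≈-sym p) (≈-trans r q)) (λ r → ≈-trans p (≈-trans r (≈-sym q)))

    χ-sym : ∀ g h → χ g h ≡ χ h g
    χ-sym g h = ind-cong (g ≟ h) (h ≟ g) ≈-sym ≈-sym

    χ-cancelʳ : ∀ g h k → χ (g ∙ k) (h ∙ k) ≡ χ g h
    χ-cancelʳ g h k = ind-cong ((g ∙ k) ≟ (h ∙ k)) (g ≟ h) (∙-cancelʳ k g h) ∙-congʳ

    χ-cancelˡ : ∀ g h k → χ (k ∙ g) (k ∙ h) ≡ χ g h
    χ-cancelˡ g h k = ind-cong ((k ∙ g) ≟ (k ∙ h)) (g ≟ h) (∙-cancelˡ k g h) ∙-congˡ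

    decSetoid : DecSetoid 0ℓ 0ℓ
    decSetoid = record { isDecEquivalence = record { isEquivalence = isEquivalence ; _≟_ = _≟_ } }

    -- elements may list a group element several times, so sums over G range over this list.
    V : List Carrier
    V = deduplicate _≟_ elements

    ∑χ≤1 : ∀ g {xs} → AllPairs (λ x y → ¬ (x ≈ y)) xs → ∑ xs (χ g) ≤ 1ℤ
    ∑χ≤1 g u = ∑-exclusive (g ≟_) (AllPairs.map (λ x≉y g≈x g≈y → x≉y (≈-trans (≈-sym g≈x) g≈y)) u)

    ∑V-χ : ∀ g → ∑ V (χ g) ≡ 1ℤ
    ∑V-χ g = ℤ.≤-antisym (∑χ≤1 g (deduplicate-! decSetoid elements))
      (∑-witness (g ≟_) (Membership.∈-deduplicate⁺ setoid _≟_ (λ p q → ≈-trans q (≈-sym p)) (complete g)))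

    χ-convolve : ∀ g h → ∑ V (λ v → χ g v * χ h v) ≡ χ g h
    χ-convolve g h = trans (∑-cong V pointwise)
      (trans (∑-* V (χ g h) (χ g)) (trans (cong (χ g h *_) (∑V-χ g)) (ℤ.*-identityʳ (χ g h))))
      where
      pointwise : ∀ v → χ g v * χ h v ≡ χ g h * χ g v
      pointwise v with g ≟ v
      ... | no _    = sym (ℤ.*-zeroʳ (χ g h))
      ... | yes g≈v = trans (ℤ.*-identityˡ (χ h v))
        (trans (χ-cong ≈-refl (≈-sym g≈v)) (trans (χ-sym h g) (sym (ℤ.*-identityʳ (χ g h)))))

    private variable
      I J : Set

    pairs : List I → List J → (I → Carrier) → (J → Carrier) → ℤ
    pairs X Y s t = ∑ X (λ x → ∑ Y (λ y → χ (s x) (t y)))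

    hits : List I → (I → Carrier) → Carrier → ℤ
    hits X s v = ∑ X (λ x → χ (s x) v)

    -- A coincidence count is the inner product over `G` of two multiplicity functions. Hence sums
    -- of squares over `V` yield inequalities between coincidence counts.
    ∑-hits : ∀ (X : List I) (Y : List J) s t → ∑ V (λ v → hits X s v * hits Y t v) ≡ pairs X Y s t
    ∑-hits X Y s t = begin
      ∑ V (λ v → hits X s v * hits Y t v)                       ≡⟨ ∑-cong V (λ v → ∑-product X Y (λ x → χ (s x) v) (λ y → χ (t y) v)) ⟩
      ∑ V (λ v → ∑ X (λ x → ∑ Y (λ y → χ (s x) v * χ (t y) v))) ≡⟨ ∑-swap V X (λ v x → ∑ Y (λ y → χ (s x) v * χ (t y) v)) ⟩
      ∑ X (λ x → ∑ V (λ v → ∑ Y (λ y → χ (s x) v * χ (t y) v))) ≡⟨ ∑-cong X (λ x → ∑-swap V Y (λ v y → χ (s x) v * χ (t y) v)) ⟩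
      ∑ X (λ x → ∑ Y (λ y → ∑ V (λ v → χ (s x) v * χ (t y) v))) ≡⟨ ∑-cong X (λ x → ∑-cong Y (λ y → χ-convolve (s x) (t y))) ⟩
      pairs X Y s t ∎
      where open ≡-Reasoning

    pairs-cong : ∀ (X : List I) (Y : List J) {s s' t t'} →
                 (∀ x y → χ (s x) (t y) ≡ χ (s' x) (t' y)) → pairs X Y s t ≡ pairs X Y s' t'
    pairs-cong X Y e = ∑-cong X (λ x → ∑-cong Y (λ y → e x y))

    pairs-swap : ∀ (X : List I) (Y : List J) s t → pairs X Y s t ≡ pairs Y X t s
    pairs-swap X Y s t = trans (∑-swap X Y (λ x y → χ (s x) (t y)))
      (∑-cong Y (λ y → ∑-cong X (λ x → χ-sym (s x) (t y))))

    -- Collision density when one coefficient is added.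

    -- `∣ D ∣` squared times the probability that two independent uniform entries of `D` are equal.
    energy : List Carrier → ℤ
    energy D = pairs D D (λ d → d) (λ d → d)

    energy≤ : ∀ D → energy D ≤ ∣ D ∣ * ∣ D ∣
    energy≤ D = ℤ.≤-trans (∑-mono D (λ d → ∑-mono D (λ d' → χ≤1 d d')))
      (ℤ.≤-reflexive (trans (∑-cong D (λ d → trans (∑-const D 1ℤ) (ℤ.*-identityʳ ∣ D ∣))) (∑-const D ∣ D ∣)))

    -- The excess of the collision density of D over 1/5, scaled by 5∣D∣².
    excess : List Carrier → ℤ
    excess D = + 5 * energy D - ∣ D ∣ * ∣ D ∣

    -- The distribution of values after one more variable with coefficient `a`: the value 1 of the
    -- variable shifts `D`, the value 0 keeps it.
    double : Carrier → List Carrier → List Carrier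
    double a D = map (a ∙_) D ++ D

    ∣double∣ : ∀ a D → ∣ double a D ∣ ≡ ∣ D ∣ + ∣ D ∣
    ∣double∣ a D = cong +_ (trans (length-++ (map (a ∙_) D)) (cong (ℕ._+ length D) (length-map (a ∙_) D)))

    ∑-double : ∀ a D (F : Carrier → ℤ) → ∑ (double a D) F ≡ ∑ D (λ d → F (a ∙ d)) + ∑ D F
    ∑-double a D F = trans (∑-++ (map (a ∙_) D) D F) (cong (_+ ∑ D F) (∑-map (a ∙_) D F))

    module Shifts (a : Carrier) (D : List Carrier) where
      infixl 8 _·a
      _·a : ℕ → Carrier
      k ·a = times group k a

      shifted : ℕ → ℕ → ℤ
      shifted i j = pairs D D (λ d → i ·a ∙ d) (λ d → j ·a ∙ d)

      -- Cancelling `a` on both sides. Together with `shifted-sym` this makes `shifted i j` depend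
      -- only on the distance between `i` and `j`.
      shifted-suc : ∀ i j → shifted (suc i) (suc j) ≡ shifted i j
      shifted-suc i j = pairs-cong D D (λ d d' → trans (χ-cong (assoc a (i ·a) d) (assoc a (j ·a) d')) (χ-cancelˡ (i ·a ∙ d) (j ·a ∙ d') a))

      shifted-sym : ∀ i j → shifted i j ≡ shifted j i
      shifted-sym i j = pairs-swap D D _ _

      shifted-00 : shifted 0 0 ≡ energy D
      shifted-00 = pairs-cong D D (λ d d' → χ-cong (identityˡ d) (identityˡ d'))

      shifted-10 : shifted 1 0 ≡ pairs D D (a ∙_) (λ d → d)
      shifted-10 = pairs-cong D D (λ d d' → χ-cong (∙-congʳ (identityʳ a)) (identityˡ d'))

      energy-double : energy (double a D) ≡ (energy D + energy D) + (shifted 1 0 + shifted 1 0)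
      energy-double = begin
        energy (double a D)
          ≡⟨ ∑-double a D (λ d → ∑ (double a D) (χ d)) ⟩
        ∑ D (λ d → ∑ (double a D) (χ (a ∙ d))) + ∑ D (λ d → ∑ (double a D) (χ d))
          ≡⟨ cong₂ _+_ (∑-cong D (λ d → ∑-double a D (χ (a ∙ d)))) (∑-cong D (λ d → ∑-double a D (χ d))) ⟩
        ∑ D (λ d → ∑ D (λ d' → χ (a ∙ d) (a ∙ d')) + ∑ D (χ (a ∙ d))) + ∑ D (λ d → ∑ D (λ d' → χ d (a ∙ d')) + ∑ D (χ d))
          ≡⟨ cong₂ _+_ (∑-+ D (λ d → ∑ D (λ d' → χ (a ∙ d) (a ∙ d'))) (λ d → ∑ D (χ (a ∙ d))))
                       (∑-+ D (λ d → ∑ D (λ d' → χ d (a ∙ d'))) (λ d → ∑ D (χ d))) ⟩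
        (pairs D D (a ∙_) (a ∙_) + T) + (pairs D D (λ d → d) (a ∙_) + energy D)
          ≡⟨ cong₂ (λ x y → (x + T) + (y + energy D)) (pairs-cong D D (λ d d' → χ-cancelˡ d d' a)) (pairs-swap D D (λ d → d) (a ∙_)) ⟩
        (energy D + T) + (T + energy D)
          ≡⟨ identity (energy D) T ⟩
        (energy D + energy D) + (T + T)
          ≡⟨ cong (λ t → (energy D + energy D) + (t + t)) (sym shifted-10) ⟩
        (energy D + energy D) + (shifted 1 0 + shifted 1 0) ∎
        where
        open ≡-Reasoning
        T = pairs D D (a ∙_) (λ d → d)
        identity : ∀ e t → (e + t) + (t + e) ≡ (e + e) + (t + t)
        identity = solve-∀

      -- ∑ᵥ (c(v) - 2 c(v - a) + c(v - 2a))² ≥ 0, where c(v) is the multiplicity of v in D.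
      second-difference : + 4 * shifted 1 0 ≤ + 3 * energy D + shifted 2 0
      second-difference = cancel-≤ (+ 2) (≤-by square (∑-nonneg V (λ v → 0≤square (c 0 v - + 2 * c 1 v + c 2 v))) conclusion)
        where
        open ≡-Reasoning
        c : ℕ → Carrier → ℤ
        c i = hits D (λ d → i ·a ∙ d)
        square : ℤ
        square = ∑ V (λ v → (c 0 v - + 2 * c 1 v + c 2 v) * (c 0 v - + 2 * c 1 v + c 2 v))
        S : ℕ → ℕ → ℤ
        S i j = ∑ V (λ v → c i v * c j v)
        S≡ : ∀ i j → S i j ≡ shifted i j
        S≡ i j = ∑-hits D D (λ d → i ·a ∙ d) (λ d → j ·a ∙ d)
        expand : ∀ x y z → (x - + 2 * y + z) * (x - + 2 * y + z) ≡
                 x * x + (+ 4 * (y * y) + (z * z + (ℤ.- + 4 * (y * x) + (+ 2 * (z * x) + ℤ.- + 4 * (z * y)))))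
        expand = solve-∀
        sum6 : ∀ (f₁ f₂ f₃ f₄ f₅ f₆ : Carrier → ℤ) →
               ∑ V (λ v → f₁ v + (+ 4 * f₂ v + (f₃ v + (ℤ.- + 4 * f₄ v + (+ 2 * f₅ v + ℤ.- + 4 * f₆ v))))) ≡
               ∑ V f₁ + (+ 4 * ∑ V f₂ + (∑ V f₃ + (ℤ.- + 4 * ∑ V f₄ + (+ 2 * ∑ V f₅ + ℤ.- + 4 * ∑ V f₆))))
        sum6 f₁ f₂ f₃ f₄ f₅ f₆ =
          trans (∑-+ V f₁ _) (+-congʳ (∑ V f₁)
            (trans (∑-+ V (λ v → + 4 * f₂ v) _) (cong₂ _+_ (∑-* V (+ 4) f₂)
              (trans (∑-+ V f₃ _) (+-congʳ (∑ V f₃)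
                (trans (∑-+ V (λ v → ℤ.- + 4 * f₄ v) _) (cong₂ _+_ (∑-* V (ℤ.- + 4) f₄)
                  (trans (∑-+ V (λ v → + 2 * f₅ v) _) (cong₂ _+_ (∑-* V (+ 2) f₅) (∑-* V (ℤ.- + 4) f₆))))))))))
        square≡ : square ≡ S 0 0 + (+ 4 * S 1 1 + (S 2 2 + (ℤ.- + 4 * S 1 0 + (+ 2 * S 2 0 + ℤ.- + 4 * S 2 1))))
        square≡ = trans (∑-cong V (λ v → expand (c 0 v) (c 1 v) (c 2 v)))
          (sum6 (λ v → c 0 v * c 0 v) (λ v → c 1 v * c 1 v) (λ v → c 2 v * c 2 v)
                (λ v → c 1 v * c 0 v) (λ v → c 2 v * c 0 v) (λ v → c 2 v * c 1 v))
        -- With `e` the energy and `p`, `q` the correlations at distances 1 and 2, the sum of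
        -- squares is `6e - 8p + 2q`.
        collect : ∀ e p q → + 2 * (+ 3 * e + q) ≡ + 2 * (+ 4 * p) + (e + (+ 4 * e + (e + (ℤ.- + 4 * p + (+ 2 * q + ℤ.- + 4 * p)))))
        collect = solve-∀
        S00 : S 0 0 ≡ energy D
        S00 = trans (S≡ 0 0) shifted-00
        S11 : S 1 1 ≡ energy D
        S11 = trans (S≡ 1 1) (trans (shifted-suc 0 0) shifted-00)
        S22 : S 2 2 ≡ energy D
        S22 = trans (S≡ 2 2) (trans (shifted-suc 1 1) (trans (shifted-suc 0 0) shifted-00))
        S21 : S 2 1 ≡ shifted 1 0
        S21 = trans (S≡ 2 1) (shifted-suc 1 0)
        form : ℤ → ℤ → ℤ → ℤ → ℤ → ℤ → ℤ
        form x y z p q r = x + (+ 4 * y + (z + (ℤ.- + 4 * p + (+ 2 * q + ℤ.- + 4 * r))))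
        square≡form : square ≡ form (energy D) (energy D) (energy D) (shifted 1 0) (shifted 2 0) (shifted 1 0)
        square≡form = begin
          square ≡⟨ square≡ ⟩
          form (S 0 0) (S 1 1) (S 2 2) (S 1 0) (S 2 0) (S 2 1)
            ≡⟨ cong₂ (λ x y → form x y (S 2 2) (S 1 0) (S 2 0) (S 2 1)) S00 S11 ⟩
          form (energy D) (energy D) (S 2 2) (S 1 0) (S 2 0) (S 2 1)
            ≡⟨ cong₂ (λ x y → form (energy D) (energy D) x y (S 2 0) (S 2 1)) S22 (S≡ 1 0) ⟩
          form (energy D) (energy D) (energy D) (shifted 1 0) (S 2 0) (S 2 1)
            ≡⟨ cong₂ (λ x y → form (energy D) (energy D) (energy D) (shifted 1 0) x y) (S≡ 2 0) S21 ⟩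
          form (energy D) (energy D) (energy D) (shifted 1 0) (shifted 2 0) (shifted 1 0) ∎
        conclusion : + 2 * (+ 3 * energy D + shifted 2 0) ≡ + 2 * (+ 4 * shifted 1 0) + square
        conclusion = trans (collect (energy D) (shifted 1 0) (shifted 2 0)) (+-congʳ (+ 2 * (+ 4 * shifted 1 0)) (sym square≡form))

    module _ (torsionFree : TorsionFree G) where

      multiples-distinct : ∀ {a} → ¬ (a ≈ ε) → ∀ i k → k ℕ.< 4 → ¬ (times group i a ≈ times group (i ℕ.+ suc k) a)
      multiples-distinct a≉ε zero    k k<4 e = a≉ε (torsionFree k _ k<4 (≈-sym e))
      multiples-distinct a≉ε (suc i) k k<4 e = multiples-distinct a≉ε i k k<4 (∙-cancelˡ _ _ _ e)

      -- For fixed `d` and `d'`, the element `2a + d` equals at most one of the five distinct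
      -- elements `ja + d'`. Shifting by the middle multiple produces the distances 2, 1, 0, 1, 2,
      -- so no correlation beyond distance 2 appears.
      five-shifts : ∀ {a} → ¬ (a ≈ ε) → ∀ D → let open Shifts a D in
                    energy D + (+ 2 * shifted 1 0 + + 2 * shifted 2 0) ≤ ∣ D ∣ * ∣ D ∣
      five-shifts {a} a≉ε D = subst (_≤ ∣ D ∣ * ∣ D ∣) total
          (ℤ.≤-trans (∑-mono D (λ d → ∑-mono D (λ d' → bound d d')))
            (ℤ.≤-reflexive (trans (∑-cong D (λ d → trans (∑-const D 1ℤ) (ℤ.*-identityʳ ∣ D ∣))) (∑-const D ∣ D ∣))))
        where
        open Shifts a D
        js : List ℕ
        js = 0 ∷ 1 ∷ 2 ∷ 3 ∷ 4 ∷ []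
        multiples : Carrier → List Carrier
        multiples d = map (λ j → j ·a ∙ d) js
        ne : ∀ i k d → k ℕ.≤ 3 → ¬ (i ·a ∙ d ≈ (i ℕ.+ suc k) ·a ∙ d)
        ne i k d k≤3 e = multiples-distinct a≉ε i k (s≤s k≤3) (∙-cancelʳ d _ _ e)
        distinct : ∀ d → AllPairs (λ x y → ¬ (x ≈ y)) (multiples d)
        distinct d =
          (ne 0 0 d z≤n ∷ ne 0 1 d (s≤s z≤n) ∷ ne 0 2 d (s≤s (s≤s z≤n)) ∷ ne 0 3 d (s≤s (s≤s (s≤s z≤n))) ∷ []) ∷
          (ne 1 0 d z≤n ∷ ne 1 1 d (s≤s z≤n) ∷ ne 1 2 d (s≤s (s≤s z≤n)) ∷ []) ∷
          (ne 2 0 d z≤n ∷ ne 2 1 d (s≤s z≤n) ∷ []) ∷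
          (ne 3 0 d z≤n ∷ []) ∷ [] ∷ []
        bound : ∀ d d' → ∑ js (λ j → χ (2 ·a ∙ d) (j ·a ∙ d')) ≤ 1ℤ
        bound d d' = subst (_≤ 1ℤ) (∑-map (λ j → j ·a ∙ d') js (χ (2 ·a ∙ d))) (∑χ≤1 (2 ·a ∙ d) (distinct d'))
        swapped : ∑ D (λ d → ∑ D (λ d' → ∑ js (λ j → χ (2 ·a ∙ d) (j ·a ∙ d')))) ≡ ∑ js (shifted 2)
        swapped = trans (∑-cong D (λ d → ∑-swap D js (λ d' j → χ (2 ·a ∙ d) (j ·a ∙ d'))))
          (∑-swap D js (λ d j → ∑ D (λ d' → χ (2 ·a ∙ d) (j ·a ∙ d'))))
        21≡10 : shifted 2 1 ≡ shifted 1 0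
        21≡10 = shifted-suc 1 0
        22≡00 : shifted 2 2 ≡ energy D
        22≡00 = trans (shifted-suc 1 1) (trans (shifted-suc 0 0) shifted-00)
        23≡10 : shifted 2 3 ≡ shifted 1 0
        23≡10 = trans (shifted-suc 1 2) (trans (shifted-suc 0 1) (shifted-sym 0 1))
        24≡20 : shifted 2 4 ≡ shifted 2 0
        24≡20 = trans (shifted-suc 1 3) (trans (shifted-suc 0 2) (shifted-sym 0 2))
        identity : ∀ e p q → q + (p + (e + (p + (q + 0ℤ)))) ≡ e + (+ 2 * p + + 2 * q)
        identity = solve-∀
        total : ∑ D (λ d → ∑ D (λ d' → ∑ js (λ j → χ (2 ·a ∙ d) (j ·a ∙ d')))) ≡ energy D + (+ 2 * shifted 1 0 + + 2 * shifted 2 0)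
        total = trans swapped (trans
          (+-congʳ (shifted 2 0) (cong₂ _+_ 21≡10 (cong₂ _+_ 22≡00 (cong₂ _+_ 23≡10 (cong (_+ 0ℤ) 24≡20)))))
          (identity (energy D) (shifted 1 0) (shifted 2 0)))

      -- Eliminating the correlation at distance 2 from `second-difference` and `five-shifts` leaves
      -- `10p ≤ 5e + N²`, with `e` the energy, `p` the correlation at distance 1 and `N` the length.
      -- The squared length grows by 4, so the normalised excess shrinks by 3/4.
      excess-double : ∀ {a} → ¬ (a ≈ ε) → ∀ D → excess (double a D) ≤ + 3 * excess D
      excess-double {a} a≉ε D = ≤-by slack
          ((0≤+ 2 ⊗ gap second-difference) ⊕ gap (five-shifts a≉ε D))
          (trans (identity (energy D) (shifted 1 0) (shifted 2 0) ∣ D ∣)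
                 (cong₂ (λ x y → + 5 * x - y * y + slack) (sym energy-double) (sym (∣double∣ a D))))
        where
        open Shifts a D
        slack : ℤ
        slack = + 2 * (+ 3 * energy D + shifted 2 0 - + 4 * shifted 1 0) +
                (∣ D ∣ * ∣ D ∣ - (energy D + (+ 2 * shifted 1 0 + + 2 * shifted 2 0)))
        identity : ∀ e p q N → + 3 * (+ 5 * e - N * N) ≡
          + 5 * ((e + e) + (p + p)) - (N + N) * (N + N) + (+ 2 * (+ 3 * e + q - + 4 * p) + (N * N - (e + (+ 2 * p + + 2 * q))))
        identity = solve-∀

    -- Weights and anticoncentration of linear polynomials.

    nonzero : Carrier → ℕ
    nonzero a with a ≟ ε
    ... | yes _ = 0
    ... | no _  = 1

    nonzero-no : ∀ {a} → ¬ (a ≈ ε) → nonzero a ≡ 1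
    nonzero-no {a} a≉ε with a ≟ ε
    ... | yes a≈ε = contradiction a≈ε a≉ε
    ... | no _    = refl

    nonzero-yes : ∀ {a} → a ≈ ε → nonzero a ≡ 0
    nonzero-yes {a} a≈ε with a ≟ ε
    ... | yes _   = refl
    ... | no a≉ε = contradiction a≈ε a≉ε

    weight : ∀ {n} → Vec Carrier n → ℕ
    weight []       = 0
    weight (a ∷ as) = nonzero a ℕ.+ weight as

    -- The size of the intersection of the two supports.
    common : ∀ {n} → Vec Carrier n → Vec Carrier n → ℤ
    common {n} as bs = ∑ (coordinates n) (λ k → + nonzero (lookup as k) * + nonzero (lookup bs k))

    sums : ∀ {n} → Vec Carrier n → List Carrier
    sums {n} as = map (linSum as) (cube n)

    ∣sums∣ : ∀ {n} (as : Vec Carrier n) → ∣ sums as ∣ ≡ 2^ n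
    ∣sums∣ {n} as = trans (cong +_ (length-map (linSum as) (cube n))) (∣cube∣ n)

    -- On the half where the new variable is 0, `linSum` carries an extra `ε`. The two lists
    -- therefore match only up to `≈`, and the summand has to respect it.
    ∑-sums : ∀ {n} a (as : Vec Carrier n) (F : Carrier → ℤ) → (∀ {g h} → g ≈ h → F g ≡ F h) →
             ∑ (sums (a ∷ as)) F ≡ ∑ (double a (sums as)) F
    ∑-sums {n} a as F F-cong = begin
      ∑ (sums (a ∷ as)) F
        ≡⟨ ∑-map (linSum (a ∷ as)) (cube (suc n)) F ⟩
      ∑ (cube (suc n)) (λ x → F (linSum (a ∷ as) x))
        ≡⟨ ∑-cube n (λ x → F (linSum (a ∷ as) x)) ⟩
      ∑ (cube n) (λ x → F (a ∙ linSum as x)) + ∑ (cube n) (λ x → F (ε ∙ linSum as x))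
        ≡⟨ cong₂ _+_ (sym (∑-map (linSum as) (cube n) (λ d → F (a ∙ d))))
             (trans (∑-cong (cube n) (λ x → F-cong (identityˡ (linSum as x)))) (sym (∑-map (linSum as) (cube n) F))) ⟩
      ∑ (sums as) (λ d → F (a ∙ d)) + ∑ (sums as) F
        ≡⟨ sym (∑-double a (sums as) F) ⟩
      ∑ (double a (sums as)) F ∎
      where open ≡-Reasoning

    energy-sums : ∀ {n} a (as : Vec Carrier n) → energy (sums (a ∷ as)) ≡ energy (double a (sums as))
    energy-sums a as =
      trans (∑-cong (sums (a ∷ as)) (λ d → ∑-sums a as (χ d) (χ-cong ≈-refl)))
        (∑-sums a as (λ d → ∑ (double a (sums as)) (χ d)) (λ e → ∑-cong (double a (sums as)) (λ d' → χ-cong e ≈-refl)))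

    excess-sums : ∀ {n} a (as : Vec Carrier n) → excess (sums (a ∷ as)) ≡ excess (double a (sums as))
    excess-sums {n} a as = cong₂ (λ e l → + 5 * e - l * l) (energy-sums a as)
      (trans (∣sums∣ (a ∷ as)) (trans (2^suc n)
        (sym (trans (∣double∣ a (sums as)) (cong (λ l → l + l) (∣sums∣ as))))))

    excess-double-ε : ∀ {a} → a ≈ ε → ∀ D → excess (double a D) ≡ + 4 * excess D
    excess-double-ε {a} a≈ε D = trans
      (cong₂ (λ x y → + 5 * x - y * y)
        (trans energy-double (cong (λ t → (energy D + energy D) + (t + t)) same)) (∣double∣ a D))
      (identity (energy D) ∣ D ∣)
      where
      open Shifts a D
      same : shifted 1 0 ≡ energy D
      same = trans shifted-10 (pairs-cong D D (λ d d' → χ-cong (≈-trans (∙-congʳ a≈ε) (identityˡ d)) ≈-refl))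
      identity : ∀ e N → + 5 * ((e + e) + (e + e)) - (N + N) * (N + N) ≡ + 4 * (+ 5 * e - N * N)
      identity = solve-∀

    excess≤ : ∀ D → excess D ≤ + 4 * (∣ D ∣ * ∣ D ∣)
    excess≤ D = ≤-by (+ 5 * (∣ D ∣ * ∣ D ∣ - energy D)) (0≤+ 5 ⊗ gap (energy≤ D)) (identity (energy D) ∣ D ∣)
      where
      identity : ∀ e N → + 4 * (N * N) ≡ + 5 * e - N * N + + 5 * (N * N - e)
      identity = solve-∀

    -- AM-GM for the multiplicity functions of D and v - S.
    two-parts : ∀ D S v → + 4 * energy D ≤ ∣ D ∣ * ∣ D ∣ → + 4 * energy S ≤ ∣ S ∣ * ∣ S ∣ →
                .{{_ : ℤ.Positive ∣ S ∣}} →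
                + 4 * ∑ D (λ d → ∑ S (λ s → χ (d ∙ s) v)) ≤ ∣ D ∣ * ∣ S ∣
    two-parts []         S v hD hS = ℤ.≤-refl
    two-parts D@(_ ∷ D') S v hD hS = cancel-≤ ∣ D ∣ (cancel-≤ ∣ S ∣ (cancel-≤ (+ 2)
        (≤-by slack (0≤+ 4 ⊗ 0≤squares ⊕ (0≤square ∣ S ∣ ⊗ gap hD ⊕ 0≤square ∣ D ∣ ⊗ gap hS)) conclusion)))
      where
      open ≡-Reasoning
      X = ∑ D (λ d → ∑ S (λ s → χ (d ∙ s) v))
      N = ∣ D ∣
      M = ∣ S ∣
      p q : Carrier → ℤ
      p = hits D (λ d → d)
      q = hits S (λ s → v ∙ s ⁻¹)
      -- Scaling each function by the length of the other list gives both the same total mass.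
      squares = ∑ V (λ u → (M * p u - N * q u) * (M * p u - N * q u))
      slack = + 4 * squares + ((M * M) * (N * N - + 4 * energy D) + (N * N) * (M * M - + 4 * energy S))
      0≤squares : 0ℤ ≤ squares
      0≤squares = ∑-nonneg V (λ u → 0≤square (M * p u - N * q u))
      pp : ∑ V (λ u → p u * p u) ≡ energy D
      pp = ∑-hits D D (λ d → d) (λ d → d)
      pq : ∑ V (λ u → p u * q u) ≡ X
      pq = trans (∑-hits D S (λ d → d) (λ s → v ∙ s ⁻¹)) (∑-cong D (λ d → ∑-cong S (λ s →
        ind-cong (d ≟ (v ∙ s ⁻¹)) ((d ∙ s) ≟ v)
          (λ e → ≈-trans (∙-congʳ e) (≈-trans (assoc v (s ⁻¹) s) (≈-trans (∙-congˡ (inverseˡ s)) (identityʳ v))))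
          (λ e → ≈-trans (≈-sym (≈-trans (assoc d s (s ⁻¹)) (≈-trans (∙-congˡ (inverseʳ s)) (identityʳ d)))) (∙-congʳ e)))))
      qq : ∑ V (λ u → q u * q u) ≡ energy S
      qq = trans (∑-hits S S (λ s → v ∙ s ⁻¹) (λ s → v ∙ s ⁻¹)) (pairs-cong S S (λ s t →
        ind-cong ((v ∙ s ⁻¹) ≟ (v ∙ t ⁻¹)) (s ≟ t) (λ e → ⁻¹-injective (∙-cancelˡ v _ _ e)) (λ e → ∙-congˡ (⁻¹-cong e))))
      expand : ∀ M N p q → (M * p - N * q) * (M * p - N * q) ≡
               (M * M) * (p * p) + ((ℤ.- (+ 2 * (M * N))) * (p * q) + (N * N) * (q * q))
      expand = solve-∀
      squares≡ : squares ≡ (M * M) * energy D + ((ℤ.- (+ 2 * (M * N))) * X + (N * N) * energy S)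
      squares≡ = begin
        squares
          ≡⟨ ∑-cong V (λ u → expand M N (p u) (q u)) ⟩
        ∑ V (λ u → (M * M) * (p u * p u) + ((ℤ.- (+ 2 * (M * N))) * (p u * q u) + (N * N) * (q u * q u)))
          ≡⟨ ∑-+ V (λ u → (M * M) * (p u * p u)) (λ u → (ℤ.- (+ 2 * (M * N))) * (p u * q u) + (N * N) * (q u * q u)) ⟩
        ∑ V (λ u → (M * M) * (p u * p u)) + ∑ V (λ u → (ℤ.- (+ 2 * (M * N))) * (p u * q u) + (N * N) * (q u * q u))
          ≡⟨ +-congʳ (∑ V (λ u → (M * M) * (p u * p u)))
               (∑-+ V (λ u → (ℤ.- (+ 2 * (M * N))) * (p u * q u)) (λ u → (N * N) * (q u * q u))) ⟩
        ∑ V (λ u → (M * M) * (p u * p u)) +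
          (∑ V (λ u → (ℤ.- (+ 2 * (M * N))) * (p u * q u)) + ∑ V (λ u → (N * N) * (q u * q u)))
          ≡⟨ cong₂ _+_ (trans (∑-* V (M * M) (λ u → p u * p u)) (cong ((M * M) *_) pp))
               (cong₂ _+_ (trans (∑-* V (ℤ.- (+ 2 * (M * N))) (λ u → p u * q u)) (cong ((ℤ.- (+ 2 * (M * N))) *_) pq))
                          (trans (∑-* V (N * N) (λ u → q u * q u)) (cong ((N * N) *_) qq))) ⟩
        (M * M) * energy D + ((ℤ.- (+ 2 * (M * N))) * X + (N * N) * energy S) ∎
      collect : ∀ M N X E F → + 2 * (M * (N * (N * M))) ≡ + 2 * (M * (N * (+ 4 * X))) +
        (+ 4 * ((M * M) * E + ((ℤ.- (+ 2 * (M * N))) * X + (N * N) * F)) + ((M * M) * (N * N - + 4 * E) + (N * N) * (M * M - + 4 * F)))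
      collect = solve-∀
      conclusion : + 2 * (M * (N * (N * M))) ≡ + 2 * (M * (N * (+ 4 * X))) + slack
      conclusion = trans (collect M N X (energy D) (energy S))
        (cong (λ z → + 2 * (M * (N * (+ 4 * X))) +
                     (+ 4 * z + ((M * M) * (N * N - + 4 * energy D) + (N * N) * (M * M - + 4 * energy S))))
              (sym squares≡))

    -- The excess is scaled by 5, so an excess of at most a quarter of the squared length means
    -- density at most 1/5 + 1/20 = 1/4.
    4energy≤ : ∀ D → + 4 * excess D ≤ ∣ D ∣ * ∣ D ∣ → + 4 * energy D ≤ ∣ D ∣ * ∣ D ∣
    4energy≤ D h = cancel-≤ (+ 5) (≤-by (∣ D ∣ * ∣ D ∣ - + 4 * excess D) (gap h) (identity (energy D) ∣ D ∣))
      where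
      identity : ∀ e N → + 5 * (N * N) ≡ + 5 * (+ 4 * e) + (N * N - + 4 * (+ 5 * e - N * N))
      identity = solve-∀

    module _ (torsionFree : TorsionFree G) where

      -- The normalised excess is at most 4 for every multiset; a nonzero coefficient multiplies it
      -- by at most 3/4 and a zero one leaves it unchanged. Allowing any `j` up to the weight lets a
      -- fixed number of steps be used for all heavier polynomials.
      excess-decay : ∀ {n} (as : Vec Carrier n) j → j ℕ.≤ weight as →
                     (+ 4) ^ j * excess (sums as) ≤ (+ 4 * (+ 3) ^ j) * (2^ n * 2^ n)
      excess-decay as zero j≤ = subst₂ _≤_ (sym (ℤ.*-identityˡ (excess (sums as))))
        (cong (λ l → + 4 * (l * l)) (∣sums∣ as)) (excess≤ (sums as))
      excess-decay {suc n} (a ∷ as) (suc j) j≤ with a ≟ ε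
      ... | yes a≈ε = ≤-by (+ 4 * ((+ 4 * t) * (q * q) - f * x)) (0≤+ 4 ⊗ gap (excess-decay as (suc j) j≤))
            (trans (cong (λ z → (+ 4 * t) * (z * z)) (2^suc n))
              (trans (identity f t q x) (cong (λ z → f * z + + 4 * ((+ 4 * t) * (q * q) - f * x))
                (sym (trans (excess-sums a as) (excess-double-ε a≈ε (sums as)))))))
        where
        f = (+ 4) ^ suc j
        t = (+ 3) ^ suc j
        q = 2^ n
        x = excess (sums as)
        identity : ∀ f t q x → (+ 4 * t) * ((q + q) * (q + q)) ≡ f * (+ 4 * x) + + 4 * ((+ 4 * t) * (q * q) - f * x)
        identity = solve-∀
      ... | no a≉ε = ≤-by ((+ 4 * f) * (+ 3 * x - y) + + 12 * ((+ 4 * t) * (q * q) - f * x))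
            ((0≤+ 4 ⊗ 0≤^ 4 j) ⊗ gap step ⊕ 0≤+ 12 ⊗ gap (excess-decay as j (ℕ.s≤s⁻¹ j≤)))
            (trans (cong (λ z → (+ 4 * (+ 3 * t)) * (z * z)) (2^suc n)) (identity f t q x y))
        where
        f = (+ 4) ^ j
        t = (+ 3) ^ j
        q = 2^ n
        x = excess (sums as)
        y = excess (sums (a ∷ as))
        step : y ≤ + 3 * x
        step = subst (_≤ + 3 * x) (sym (excess-sums a as)) (excess-double torsionFree a≉ε (sums as))
        identity : ∀ f t q x y → (+ 4 * (+ 3 * t)) * ((q + q) * (q + q)) ≡
          (+ 4 * f) * y + ((+ 4 * f) * (+ 3 * x - y) + + 12 * ((+ 4 * t) * (q * q) - f * x))
        identity = solve-∀

      -- The condition on `k` says that 16 times the `k`-th power of 3/4 is at most 1, which brings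
      -- the bound of `excess-decay` down to 1/4.
      sparse-energy : ∀ {n} (as : Vec Carrier n) k → k ℕ.≤ weight as → + 16 * (+ 3) ^ k ≤ (+ 4) ^ k →
                      + 4 * energy (sums as) ≤ ∣ sums as ∣ * ∣ sums as ∣
      sparse-energy {n} as k k≤ hk = 4energy≤ (sums as) (subst (+ 4 * x ≤_) (cong (λ l → l * l) (sym (∣sums∣ as)))
          (cancel-≤ f {{4^-positive k}}
            (≤-by (+ 4 * ((+ 4 * t) * (q * q) - f * x) + (f - + 16 * t) * (q * q))
              (0≤+ 4 ⊗ gap (excess-decay as k k≤) ⊕ gap hk ⊗ 0≤square q)
              (identity f t q x))))
        where
        f = (+ 4) ^ k
        t = (+ 3) ^ k
        q = 2^ n
        x = excess (sums as)
        identity : ∀ f t q x → f * (q * q) ≡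
          f * (+ 4 * x) + (+ 4 * ((+ 4 * t) * (q * q) - f * x) + (f - + 16 * t) * (q * q))
        identity = solve-∀

      -- The first `m` nonzero coefficients are absorbed into `D`, and at least `k` nonzero ones
      -- remain for the second summand of `two-parts`. The hypothesis on `excess D` is the invariant
      -- that `m` further absorptions bring the collision density of `D` down to 1/4.
      concentration : ∀ {n} (as : Vec Carrier n) D m k → m ℕ.+ k ℕ.≤ weight as → + 16 * (+ 3) ^ k ≤ (+ 4) ^ k →
                      (+ 4 * (+ 3) ^ m) * excess D ≤ (+ 4) ^ m * (∣ D ∣ * ∣ D ∣) → ∀ v →
                      + 4 * ∑ D (λ d → ∑ (cube n) (λ x → χ (d ∙ linSum as x) v)) ≤ ∣ D ∣ * 2^ n
      concentration {n} as D zero k m≤ hk h v =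
        subst₂ (λ s l → + 4 * s ≤ ∣ D ∣ * l) (∑-cong D (λ d → ∑-map (linSum as) (cube n) (λ s → χ (d ∙ s) v))) (∣sums∣ as)
          (two-parts D (sums as) v (4energy≤ D (subst₂ _≤_ refl (ℤ.*-identityˡ (∣ D ∣ * ∣ D ∣)) h)) (sparse-energy as k m≤ hk)
            {{subst ℤ.Positive (sym (∣sums∣ as)) (2^-positive n)}})
      concentration {suc n} (a ∷ as) D (suc m) k m≤ hk h v = subst₂ _≤_ (cong (+ 4 *_) (sym unfold)) size (go (a ≟ ε))
        where
        open ≡-Reasoning
        D' = double a D
        f = (+ 4) ^ m
        t = (+ 3) ^ m
        N = ∣ D ∣
        goal : Set
        goal = + 4 * ∑ D' (λ d → ∑ (cube n) (λ x → χ (d ∙ linSum as x) v)) ≤ ∣ D' ∣ * 2^ n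
        go : Dec (a ≈ ε) → goal
        -- A zero coefficient doubles the list without changing its normalised excess, so `m` stays
        -- the same.
        go (yes a≈ε) = concentration as D' (suc m) k (subst (λ z → suc m ℕ.+ k ℕ.≤ z ℕ.+ weight as) (nonzero-yes a≈ε) m≤) hk
            (≤-by _ (0≤+ 4 ⊗ gap h) (trans (cong (λ l → (+ 4 * f) * (l * l)) (∣double∣ a D))
              (trans (identity f t N (excess D))
                (cong (λ z → (+ 4 * (+ 3 * t)) * z + + 4 * ((+ 4 * f) * (N * N) - (+ 4 * (+ 3 * t)) * excess D))
                  (sym (excess-double-ε a≈ε D)))))) v
          where
          identity : ∀ f t N x → (+ 4 * f) * ((N + N) * (N + N)) ≡
            (+ 4 * (+ 3 * t)) * (+ 4 * x) + + 4 * ((+ 4 * f) * (N * N) - (+ 4 * (+ 3 * t)) * x)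
          identity = solve-∀
        go (no a≉ε) = concentration as D' m k (ℕ.s≤s⁻¹ (subst (λ z → suc m ℕ.+ k ℕ.≤ z ℕ.+ weight as) (nonzero-no a≉ε) m≤)) hk
            (≤-by ((+ 4 * t) * (+ 3 * x - y) + ((+ 4 * f) * (N * N) - (+ 4 * (+ 3 * t)) * x))
              (0≤+ 4 ⊗ 0≤^ 3 m ⊗ gap (excess-double torsionFree a≉ε D) ⊕ gap h)
              (trans (cong (λ l → f * (l * l)) (∣double∣ a D)) (identity f t N x y))) v
          where
          x = excess D
          y = excess D'
          identity : ∀ f t N x y → f * ((N + N) * (N + N)) ≡
            (+ 4 * t) * y + ((+ 4 * t) * (+ 3 * x - y) + ((+ 4 * f) * (N * N) - (+ 4 * (+ 3 * t)) * x))
          identity = solve-∀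
        size : ∣ D' ∣ * 2^ n ≡ N * 2^ (suc n)
        size = trans (cong (_* 2^ n) (∣double∣ a D)) (trans (identity N (2^ n)) (cong (N *_) (sym (2^suc n))))
          where
          identity : ∀ N q → (N + N) * q ≡ N * (q + q)
          identity = solve-∀
        rearrange : ∀ d x → d ∙ (a ∙ linSum as x) ≈ (a ∙ d) ∙ linSum as x
        rearrange d x = ≈-trans (≈-sym (assoc d a _)) (∙-congʳ (comm d a))
        unfold : ∑ D (λ d → ∑ (cube (suc n)) (λ x → χ (d ∙ linSum (a ∷ as) x) v)) ≡
                 ∑ D' (λ d → ∑ (cube n) (λ x → χ (d ∙ linSum as x) v))
        unfold = begin
          ∑ D (λ d → ∑ (cube (suc n)) (λ x → χ (d ∙ linSum (a ∷ as) x) v))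
            ≡⟨ ∑-cong D (λ d → ∑-cube n (λ x → χ (d ∙ linSum (a ∷ as) x) v)) ⟩
          ∑ D (λ d → ∑ (cube n) (λ x → χ (d ∙ (a ∙ linSum as x)) v) + ∑ (cube n) (λ x → χ (d ∙ (ε ∙ linSum as x)) v))
            ≡⟨ ∑-cong D (λ d → cong₂ _+_ (∑-cong (cube n) (λ x → χ-cong (rearrange d x) ≈-refl))
                                         (∑-cong (cube n) (λ x → χ-cong (∙-congˡ (identityˡ _)) ≈-refl))) ⟩
          ∑ D (λ d → ∑ (cube n) (λ x → χ ((a ∙ d) ∙ linSum as x) v) + ∑ (cube n) (λ x → χ (d ∙ linSum as x) v))
            ≡⟨ ∑-+ D (λ d → ∑ (cube n) (λ x → χ ((a ∙ d) ∙ linSum as x) v)) (λ d → ∑ (cube n) (λ x → χ (d ∙ linSum as x) v)) ⟩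
          ∑ D (λ d → ∑ (cube n) (λ x → χ ((a ∙ d) ∙ linSum as x) v)) + ∑ D (λ d → ∑ (cube n) (λ x → χ (d ∙ linSum as x) v))
            ≡⟨ sym (∑-double a D (λ d → ∑ (cube n) (λ x → χ (d ∙ linSum as x) v))) ⟩
          ∑ D' (λ d → ∑ (cube n) (λ x → χ (d ∙ linSum as x) v)) ∎

      -- Absorption starts from the single constant term, whose excess is 4; this is the origin of
      -- the factor 16 in the condition on `k`. Of the `k + k` nonzero coefficients, `k` go to each
      -- of the two summands.
      dense-concentration : ∀ k → + 16 * (+ 3) ^ k ≤ (+ 4) ^ k →
                            ∀ {n} (P : Coeffs n) → k ℕ.+ k ℕ.≤ weight (proj₂ P) → ∀ v →
                            + 4 * ∑ (cube n) (λ x → χ (eval P x) v) ≤ 2^ n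
      dense-concentration k hk {n} (c , as) 2k≤ v =
        subst₂ (λ s l → + 4 * s ≤ l) (ℤ.+-identityʳ (∑ (cube n) (λ x → χ (c ∙ linSum as x) v))) (ℤ.*-identityˡ (2^ n))
          (concentration as (c ∷ []) k k 2k≤ hk initial v)
        where
        f = (+ 4) ^ k
        t = (+ 3) ^ k
        energy₁ : energy (c ∷ []) ≡ 1ℤ
        energy₁ = cong (λ z → z + 0ℤ + 0ℤ) (ind-yes (c ≟ c) ≈-refl)
        identity : ∀ f t → f * (1ℤ * 1ℤ) ≡ (+ 4 * t) * (+ 5 * 1ℤ - 1ℤ * 1ℤ) + (f - + 16 * t)
        identity = solve-∀
        initial : (+ 4 * t) * excess (c ∷ []) ≤ f * (1ℤ * 1ℤ)
        initial = subst (λ e → (+ 4 * t) * (+ 5 * e - 1ℤ * 1ℤ) ≤ f * (1ℤ * 1ℤ)) (sym energy₁)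
          (≤-by (f - + 16 * t) (gap hk) (identity f t))

    ∑χ-cube≤ : ∀ {n} (s t : Vec Bool n → Carrier) → ∑ (cube n) (λ x → χ (s x) (t x)) ≤ 2^ n
    ∑χ-cube≤ {n} s t = ℤ.≤-trans (∑-mono (cube n) (λ x → χ≤1 (s x) (t x))) (ℤ.≤-reflexive (∑-cube-1 n))

    eval-true : ∀ {n} c a (as : Vec Carrier n) x → eval (c , a ∷ as) (true ∷ x) ≈ eval (c ∙ a , as) x
    eval-true c a as x = ≈-sym (assoc c a _)

    eval-false : ∀ {n} c a (as : Vec Carrier n) x → eval (c , a ∷ as) (false ∷ x) ≈ eval (c , as) x
    eval-false c a as x = ∙-congˡ (identityˡ _)

    -- Flipping a variable with nonzero coefficient changes the value, so at most one point of each
    -- flipped pair is sent to `v`. If the first coefficient is zero, induction handles the two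
    -- halves.
    half-concentration : ∀ {n} (P : Coeffs n) → 1 ℕ.≤ weight (proj₂ P) → ∀ v → + 2 * hits (cube n) (eval P) v ≤ 2^ n
    half-concentration {suc n} (c , a ∷ as) 1≤ v = subst₂ (λ s l → + 2 * s ≤ l) (sym split) (sym (2^suc n)) (go (a ≟ ε))
      where
      H : Carrier → ℤ
      H d = hits (cube n) (eval (d , as)) v
      split : hits (cube (suc n)) (eval (c , a ∷ as)) v ≡ H (c ∙ a) + H c
      split = trans (∑-cube n (λ x → χ (eval (c , a ∷ as) x) v)) (cong₂ _+_
        (∑-cong (cube n) (λ x → χ-cong (eval-true c a as x) ≈-refl))
        (∑-cong (cube n) (λ x → χ-cong (eval-false c a as x) ≈-refl)))
      go : Dec (a ≈ ε) → + 2 * (H (c ∙ a) + H c) ≤ 2^ n + 2^ n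
      go (yes a≈ε) = ≤-by _ (gap (half-concentration (c ∙ a , as) 1≤' v) ⊕ gap (half-concentration (c , as) 1≤' v))
          (identity (H (c ∙ a)) (H c) (2^ n))
        where
        1≤' = subst (λ z → 1 ℕ.≤ z ℕ.+ weight as) (nonzero-yes a≈ε) 1≤
        identity : ∀ x y q → q + q ≡ + 2 * (x + y) + ((q - + 2 * x) + (q - + 2 * y))
        identity = solve-∀
      go (no a≉ε) = ≤-by _ (0≤+ 2 ⊗ gap bound) (identity (H (c ∙ a) + H c) (2^ n))
        where
        identity : ∀ x q → q + q ≡ + 2 * x + + 2 * (q - x)
        identity = solve-∀
        exclusive : ∀ x → χ ((c ∙ a) ∙ x) v + χ (c ∙ x) v ≤ 1ℤ
        exclusive x with ((c ∙ a) ∙ x) ≟ v | (c ∙ x) ≟ v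
        ... | no _  | no _  = 0≤+ 1
        ... | yes _ | no _  = ℤ.≤-refl
        ... | no _  | yes _ = ℤ.≤-refl
        ... | yes p | yes q = contradiction
                (identityʳ-unique c a (∙-cancelʳ x _ _ (≈-trans p (≈-sym q)))) a≉ε
        bound : H (c ∙ a) + H c ≤ 2^ n
        bound = ℤ.≤-trans (ℤ.≤-reflexive (sym (∑-+ (cube n) (λ x → χ (eval (c ∙ a , as) x) v) (λ x → χ (eval (c , as) x) v))))
          (ℤ.≤-trans (∑-mono (cube n) (λ x → exclusive (linSum as x))) (ℤ.≤-reflexive (∑-cube-1 n)))

    -- Independence of polynomials with disjoint supports.

    0≤pairs : ∀ {I J : Set} (X : List I) (Y : List J) s t → 0ℤ ≤ pairs X Y s t
    0≤pairs X Y s t = ∑-nonneg X (λ x → ∑-nonneg Y (λ y → 0≤χ (s x) (t y)))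

    0≤common : ∀ {n} (as bs : Vec Carrier n) → 0ℤ ≤ common as bs
    0≤common {n} as bs = ∑-nonneg (coordinates n) (λ k → 0≤+ (nonzero (lookup as k)) ⊗ 0≤+ (nonzero (lookup bs k)))

    common-∷ : ∀ {n} a b (as bs : Vec Carrier n) → common (a ∷ as) (b ∷ bs) ≡ + nonzero a * + nonzero b + common as bs
    common-∷ {n} a b as bs = ∑-coordinates n (λ k → + nonzero (lookup (a ∷ as) k) * + nonzero (lookup (b ∷ bs) k))

    meet : ∀ {n} → Coeffs n → Coeffs n → ℤ
    meet {n} P Q = ∑ (cube n) (λ x → χ (eval P x) (eval Q x))

    cross : ∀ {n} → Coeffs n → Coeffs n → ℤ
    cross {n} P Q = pairs (cube n) (cube n) (eval P) (eval Q)

    -- P(x) and Q(x) are independent when their supports are disjoint, that is, when the error term vanishes.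
    independence : ∀ {n} (P Q : Coeffs n) →
                   2^ n * meet P Q ≤ cross P Q + (2^ n * 2^ n) * common (proj₂ P) (proj₂ Q)
    independence {zero} (c , []) (d , []) = ℤ.≤-reflexive (identity (χ (c ∙ ε) (d ∙ ε)))
      where
      identity : ∀ x → 1ℤ * (x + 0ℤ) ≡ x + 0ℤ + 0ℤ + 0ℤ
      identity = solve-∀
    independence {suc n} (c , a ∷ as) (d , b ∷ bs) =
        subst₂ _≤_ (cong₂ _*_ (sym (2^suc n)) (sym meet≡))
          (cong₂ _+_ (sym cross≡) (cong₂ (λ z w → (z * z) * w) (sym (2^suc n)) (sym (common-∷ a b as bs)))) (go (a ≟ ε) (b ≟ ε))
      where
      q = 2^ n
      o = common as bs
      F K : Carrier → Carrier → ℤ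
      F g h = meet (g , as) (h , bs)
      K g h = cross (g , as) (h , bs)
      F-cong : ∀ {g g' h h'} → g ≈ g' → h ≈ h' → F g h ≡ F g' h'
      F-cong p r = ∑-cong (cube n) (λ x → χ-cong (∙-congʳ p) (∙-congʳ r))
      K-cong : ∀ {g g' h h'} → g ≈ g' → h ≈ h' → K g h ≡ K g' h'
      K-cong p r = pairs-cong (cube n) (cube n) (λ x y → χ-cong (∙-congʳ p) (∙-congʳ r))
      IH : ∀ g h → 0ℤ ≤ K g h + (q * q) * o - q * F g h
      IH g h = gap (independence (g , as) (h , bs))
      meet≡ : meet (c , a ∷ as) (d , b ∷ bs) ≡ F (c ∙ a) (d ∙ b) + F c d
      meet≡ = trans (∑-cube n (λ x → χ (eval (c , a ∷ as) x) (eval (d , b ∷ bs) x))) (cong₂ _+_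
        (∑-cong (cube n) (λ x → χ-cong (eval-true c a as x) (eval-true d b bs x)))
        (∑-cong (cube n) (λ x → χ-cong (eval-false c a as x) (eval-false d b bs x))))
      inner : ∀ g → ∑ (cube (suc n)) (λ y → χ g (eval (d , b ∷ bs) y)) ≡
                    ∑ (cube n) (λ y → χ g (eval (d ∙ b , bs) y)) + ∑ (cube n) (λ y → χ g (eval (d , bs) y))
      inner g = trans (∑-cube n (λ y → χ g (eval (d , b ∷ bs) y))) (cong₂ _+_
        (∑-cong (cube n) (λ y → χ-cong ≈-refl (eval-true d b bs y)))
        (∑-cong (cube n) (λ y → χ-cong ≈-refl (eval-false d b bs y))))
      row : ∀ g → ∑ (cube n) (λ x → ∑ (cube (suc n)) (λ y → χ (eval (g , as) x) (eval (d , b ∷ bs) y))) ≡ K g (d ∙ b) + K g d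
      row g = trans (∑-cong (cube n) (λ x → inner (eval (g , as) x)))
        (∑-+ (cube n) (λ x → ∑ (cube n) (λ y → χ (eval (g , as) x) (eval (d ∙ b , bs) y)))
                      (λ x → ∑ (cube n) (λ y → χ (eval (g , as) x) (eval (d , bs) y))))
      cross≡ : cross (c , a ∷ as) (d , b ∷ bs) ≡ (K (c ∙ a) (d ∙ b) + K (c ∙ a) d) + (K c (d ∙ b) + K c d)
      cross≡ = trans (∑-cube n (λ x → ∑ (cube (suc n)) (λ y → χ (eval (c , a ∷ as) x) (eval (d , b ∷ bs) y)))) (cong₂ _+_
        (trans (∑-cong (cube n) (λ x → ∑-cong (cube (suc n)) (λ y → χ-cong (eval-true c a as x) ≈-refl))) (row (c ∙ a)))
        (trans (∑-cong (cube n) (λ x → ∑-cong (cube (suc n)) (λ y → χ-cong (eval-false c a as x) ≈-refl))) (row c)))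
      goal : Set
      goal = (q + q) * (F (c ∙ a) (d ∙ b) + F c d) ≤
             (K (c ∙ a) (d ∙ b) + K (c ∙ a) d) + (K c (d ∙ b) + K c d) +
             ((q + q) * (q + q)) * (+ nonzero a * + nonzero b + o)
      0≤ab : 0ℤ ≤ + nonzero a * + nonzero b
      0≤ab = 0≤+ (nonzero a) ⊗ 0≤+ (nonzero b)
      0≤4qq : 0ℤ ≤ (q + q) * (q + q)
      0≤4qq = 0≤square (q + q)
      go : Dec (a ≈ ε) → Dec (b ≈ ε) → goal
      -- The first variable is absent from P, so both halves involve the same polynomial on that
      -- side and the induction hypothesis is used once for each half of Q.
      go (yes a≈ε) _ = subst₂ (λ f k → (q + q) * (f + F c d) ≤ k + (K c (d ∙ b) + K c d) + ((q + q) * (q + q)) * (+ nonzero a * + nonzero b + o))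
          (sym (F-cong ca≈c ≈-refl)) (cong₂ _+_ (sym (K-cong ca≈c ≈-refl)) (sym (K-cong ca≈c ≈-refl)))
          (≤-by _ (0≤4qq ⊗ 0≤ab ⊕ 0≤+ 2 ⊗ (IH c (d ∙ b) ⊕ IH c d))
            (identity (K c (d ∙ b)) (K c d) (F c (d ∙ b)) (F c d) q o (+ nonzero a * + nonzero b)))
        where
        ca≈c = ≈-trans (∙-congˡ a≈ε) (identityʳ c)
        identity : ∀ k k' f f' q o z → (k + k') + (k + k') + ((q + q) * (q + q)) * (z + o) ≡
          (q + q) * (f + f') + (((q + q) * (q + q)) * z + + 2 * ((k + (q * q) * o - q * f) + (k' + (q * q) * o - q * f')))
        identity = solve-∀
      go (no _) (yes b≈ε) = subst₂ (λ f k → (q + q) * (f + F c d) ≤ k + ((q + q) * (q + q)) * (+ nonzero a * + nonzero b + o))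
          (sym (F-cong ≈-refl db≈d))
          (cong₂ (λ k k' → (k + K (c ∙ a) d) + (k' + K c d)) (sym (K-cong ≈-refl db≈d)) (sym (K-cong ≈-refl db≈d)))
          (≤-by _ (0≤4qq ⊗ 0≤ab ⊕ 0≤+ 2 ⊗ (IH (c ∙ a) d ⊕ IH c d))
            (identity (K (c ∙ a) d) (K c d) (F (c ∙ a) d) (F c d) q o (+ nonzero a * + nonzero b)))
        where
        db≈d = ≈-trans (∙-congˡ b≈ε) (identityʳ d)
        identity : ∀ k k' f f' q o z → (k + k) + (k' + k') + ((q + q) * (q + q)) * (z + o) ≡
          (q + q) * (f + f') + (((q + q) * (q + q)) * z + + 2 * ((k + (q * q) * o - q * f) + (k' + (q * q) * o - q * f')))
        identity = solve-∀
      -- A shared variable adds 1 to the error term, and then bounding `meet` by the size of the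
      -- cube suffices.
      go (no a≉ε) (no b≉ε) = subst (λ z → (q + q) * (F (c ∙ a) (d ∙ b) + F c d) ≤ S + ((q + q) * (q + q)) * (z + o))
          (sym (cong₂ (λ x y → + x * + y) (nonzero-no a≉ε) (nonzero-no b≉ε)))
          (≤-by _ ((0≤K _ _ ⊕ 0≤K _ _ ⊕ (0≤K _ _ ⊕ 0≤K _ _)) ⊕
                   (0≤4qq ⊗ 0≤common as bs ⊕ (0≤2^ n ⊕ 0≤2^ n) ⊗ (gap (F≤ (c ∙ a) (d ∙ b)) ⊕ gap (F≤ c d))))
            (identity S (F (c ∙ a) (d ∙ b)) (F c d) q o))
        where
        S = (K (c ∙ a) (d ∙ b) + K (c ∙ a) d) + (K c (d ∙ b) + K c d)
        0≤K : ∀ g h → 0ℤ ≤ K g h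
        0≤K g h = 0≤pairs (cube n) (cube n) (eval (g , as)) (eval (h , bs))
        F≤ : ∀ g h → F g h ≤ q
        F≤ g h = ∑χ-cube≤ (eval (g , as)) (eval (h , bs))
        identity : ∀ S f f' q o → S + ((q + q) * (q + q)) * (1ℤ * 1ℤ + o) ≡
          (q + q) * (f + f') + (S + (((q + q) * (q + q)) * o + (q + q) * ((q - f) + (q - f'))))
        identity = solve-∀

    -- Differences, agreement, and pairs of nearby polynomials.

    infixl 6 _⊖_
    _⊖_ : ∀ {n} → Coeffs n → Coeffs n → Coeffs n
    (c , as) ⊖ (d , bs) = c ∙ d ⁻¹ , zipWith (λ a b → a ∙ b ⁻¹) as bs

    quotient-∙ : ∀ g h k l → (g ∙ h ⁻¹) ∙ (k ∙ l ⁻¹) ≈ (g ∙ k) ∙ (h ∙ l) ⁻¹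
    quotient-∙ g h k l = ≈-trans (interchange g (h ⁻¹) k (l ⁻¹)) (∙-congˡ (⁻¹-∙-comm h l))

    linSum-⊖ : ∀ {n} (as bs : Vec Carrier n) x → linSum (zipWith (λ a b → a ∙ b ⁻¹) as bs) x ≈ linSum as x ∙ linSum bs x ⁻¹
    linSum-⊖ []       []       []          = ≈-sym (inverseʳ ε)
    linSum-⊖ (a ∷ as) (b ∷ bs) (true ∷ x)  = ≈-trans (∙-congˡ (linSum-⊖ as bs x)) (quotient-∙ a b _ _)
    linSum-⊖ (a ∷ as) (b ∷ bs) (false ∷ x) =
      ≈-trans (∙-cong (≈-sym (inverseʳ ε)) (linSum-⊖ as bs x)) (quotient-∙ ε ε _ _)

    eval-⊖ : ∀ {n} (P Q : Coeffs n) x → eval (P ⊖ Q) x ≈ eval P x ∙ eval Q x ⁻¹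
    eval-⊖ (c , as) (d , bs) x = ≈-trans (∙-congˡ (linSum-⊖ as bs x)) (quotient-∙ c d _ _)

    agreement : ∀ {n} → (Vec Bool n → Carrier) → Coeffs n → ℤ
    agreement {n} f P = ∑ (cube n) (λ x → χ (f x) (eval P x))

    -- Agreement at least 1/2 + 1/m.
    Good : ∀ {n} → ℕ → (Vec Bool n → Carrier) → Coeffs n → Set
    Good {n} m f P = 2^ n * (+ m + + 2) ≤ (+ 2 * + m) * agreement f P

    agreement-total : ∀ {n} m (f : Vec Bool n → Carrier) {Ps : List (Coeffs n)} → All (Good m f) Ps →
      ∣ Ps ∣ * (2^ n * (+ m + + 2)) ≤ (+ 2 * + m) * ∑ (cube n) (λ x → ∑ Ps (λ P → χ (f x) (eval P x)))
    agreement-total {n} m f {Ps} good = subst₂ _≤_ (∑-const Ps (2^ n * (+ m + + 2)))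
      (trans (∑-* Ps (+ 2 * + m) (agreement f)) (cong ((+ 2 * + m) *_) (sym (∑-swap (cube n) Ps (λ x P → χ (f x) (eval P x))))))
      (∑-mono-All good)

    -- Coincidences become zeros of the difference, where anticoncentration applies.
    meet-⊖ : ∀ {n} (P Q : Coeffs n) → meet P Q ≡ hits (cube n) (eval (P ⊖ Q)) ε
    meet-⊖ {n} P Q = ∑-cong (cube n) (λ x → ind-cong (eval P x ≟ eval Q x) (eval (P ⊖ Q) x ≟ ε)
      (λ e → ≈-trans (eval-⊖ P Q x) (≈-trans (∙-congʳ e) (inverseʳ _)))
      (λ e → x∙y⁻¹≈ε⇒x≈y (eval P x) (eval Q x) (≈-trans (≈-sym (eval-⊖ P Q x)) e)))

    -- Hamming distance below `w` between the coefficient vectors; the constant terms are ignored.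
    near : ∀ {n} → ℕ → Coeffs n → Coeffs n → ℤ
    near w P Q = ind (weight (proj₂ (Q ⊖ P)) ℕ.<? w)

    -- Johnson's argument: agreement sets of density above 1/2 must often meet in more than a quarter of the cube.
    many-near-pairs : TorsionFree G → ∀ k → + 16 * (+ 3) ^ k ≤ (+ 4) ^ k →
      ∀ {n} m .{{_ : ℕ.NonZero m}} (f : Vec Bool n → Carrier) (Ps : List (Coeffs n)) → All (Good m f) Ps →
      ∣ Ps ∣ * ∣ Ps ∣ ≤ + m * ∑ Ps (λ P → ∑ Ps (near (k ℕ.+ k) P))
    many-near-pairs torsionFree k hk {n} m@(suc _) f Ps good =
        -- Expanding `bound` cancels `M²L²` and leaves `(4M + 4)L² ≤ 3M²K`; dropping `(M + 4)L²`
        -- makes the common factor `3M` cancel.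
        cancel-≤ (+ 3) (cancel-≤ M (≤-by (((M * M) * (L * L + + 3 * K) - (L * (M + + 2)) * (L * (M + + 2))) + (L * L) * (M + + 4))
          (gap bound ⊕ 0≤square L ⊗ 0≤+ _) (conclude L M K)))
      where
      L = ∣ Ps ∣
      M = + m
      N = 2^ n
      K = ∑ Ps (λ P → ∑ Ps (near (k ℕ.+ k) P))
      t : Vec Bool n → ℤ
      t x = ∑ Ps (λ P → χ (f x) (eval P x))
      T = ∑ (cube n) t
      Q = ∑ (cube n) (λ x → t x * t x)
      T≥ : L * (N * (M + + 2)) ≤ (+ 2 * M) * T
      T≥ = agreement-total m f good
      both : ∀ g h k → χ g h * χ g k ≤ χ k h
      both g h k with g ≟ h | g ≟ k
      ... | no _  | _     = 0≤χ k h
      ... | yes _ | no _  = 0≤χ k h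
      ... | yes p | yes q = ℤ.≤-reflexive (sym (ind-yes (k ≟ h) (≈-trans (≈-sym q) p)))
      Q≤ : Q ≤ ∑ Ps (λ P → ∑ Ps (λ R → meet R P))
      Q≤ = ℤ.≤-trans (∑-mono (cube n) (λ x → ℤ.≤-trans
               (ℤ.≤-reflexive (∑-product Ps Ps (λ P → χ (f x) (eval P x)) (λ P → χ (f x) (eval P x))))
               (∑-mono Ps (λ P → ∑-mono Ps (λ R → both (f x) (eval P x) (eval R x))))))
        (ℤ.≤-reflexive (trans (∑-swap (cube n) Ps (λ x P → ∑ Ps (λ R → χ (eval R x) (eval P x))))
          (∑-cong Ps (λ P → ∑-swap (cube n) Ps (λ x R → χ (eval R x) (eval P x))))))
      -- A far pair meets in at most a quarter of the cube by anticoncentration, a near pair in at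
      -- most all of it.
      meet≤ : ∀ P R → + 4 * meet R P ≤ N * (1ℤ + + 3 * near (k ℕ.+ k) P R)
      meet≤ P R with weight (proj₂ (R ⊖ P)) ℕ.<? (k ℕ.+ k)
      ... | yes _ = ≤-by _ (0≤+ 4 ⊗ gap (∑χ-cube≤ (eval R) (eval P))) (identity N (meet R P))
        where
        identity : ∀ N z → N * (1ℤ + + 3 * 1ℤ) ≡ + 4 * z + + 4 * (N - z)
        identity = solve-∀
      ... | no far = subst₂ (λ z w → + 4 * z ≤ w) (sym (meet-⊖ R P)) (identity N)
              (dense-concentration torsionFree k hk (R ⊖ P) (ℕ.≮⇒≥ far) ε)
        where
        identity : ∀ N → N ≡ N * (1ℤ + + 3 * 0ℤ)
        identity = solve-∀
      4Q≤ : + 4 * Q ≤ N * (L * L + + 3 * K)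
      4Q≤ = ℤ.≤-trans (ℤ.*-monoˡ-≤-nonNeg (+ 4) Q≤)
        (ℤ.≤-trans (ℤ.≤-reflexive (trans (sym (∑-* Ps (+ 4) _)) (∑-cong Ps (λ P → sym (∑-* Ps (+ 4) _)))))
        (ℤ.≤-trans (∑-mono Ps (λ P → ∑-mono Ps (λ R → meet≤ P R))) (ℤ.≤-reflexive collect)))
        where
        row : ∀ P → ∑ Ps (λ R → N * (1ℤ + + 3 * near (k ℕ.+ k) P R)) ≡ N * (L + + 3 * ∑ Ps (near (k ℕ.+ k) P))
        row P = trans (∑-* Ps N _) (cong (N *_) (trans (∑-+ Ps (λ _ → 1ℤ) (λ R → + 3 * near (k ℕ.+ k) P R))
          (cong₂ _+_ (sym ∣ Ps ∣≡∑1) (∑-* Ps (+ 3) (near (k ℕ.+ k) P)))))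
        collect : ∑ Ps (λ P → ∑ Ps (λ R → N * (1ℤ + + 3 * near (k ℕ.+ k) P R))) ≡ N * (L * L + + 3 * K)
        collect = trans (∑-cong Ps row) (trans (∑-* Ps N _) (cong (N *_)
          (trans (∑-+ Ps (λ _ → L) (λ P → + 3 * ∑ Ps (near (k ℕ.+ k) P)))
            (cong₂ _+_ (∑-const Ps L) (∑-* Ps (+ 3) (λ P → ∑ Ps (near (k ℕ.+ k) P)))))))
      cauchy : T * T ≤ N * Q
      cauchy = subst (λ l → T * T ≤ l * Q) (∣cube∣ n) (∑-cauchy (cube n) t)
      0≤A : 0ℤ ≤ L * (N * (M + + 2))
      0≤A = 0≤+ (length Ps) ⊗ (0≤2^ n ⊗ (0≤+ m ⊕ 0≤+ 2))
      bound : (L * (M + + 2)) * (L * (M + + 2)) ≤ (M * M) * (L * L + + 3 * K)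
      bound = cancel-≤ N {{2^-positive n}} (cancel-≤ N {{2^-positive n}}
        (≤-by _ (gap (square-mono 0≤A T≥) ⊕ (0≤+ 4 ⊗ 0≤square M ⊗ gap cauchy ⊕ 0≤square M ⊗ 0≤2^ n ⊗ gap 4Q≤))
          (identity L M N T Q (L * L + + 3 * K))))
        where
        identity : ∀ L M N T Q S → N * (N * ((M * M) * S)) ≡ N * (N * ((L * (M + + 2)) * (L * (M + + 2)))) +
          (((+ 2 * M) * T) * ((+ 2 * M) * T) - (L * (N * (M + + 2))) * (L * (N * (M + + 2))) +
            ((+ 4 * (M * M)) * (N * Q - T * T) + (M * M) * N * (N * S - + 4 * Q)))
        identity = solve-∀
      conclude : ∀ L M K → M * (+ 3 * (M * K)) ≡ M * (+ 3 * (L * L)) +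
        (((M * M) * (L * L + + 3 * K) - (L * (M + + 2)) * (L * (M + + 2))) + (L * L) * (M + + 4))
      conclude = solve-∀

    -- The second moment of the value counts and a popular variable.

    weight≡∑ : ∀ {n} (as : Vec Carrier n) → + weight as ≡ ∑ (coordinates n) (λ k → + nonzero (lookup as k))
    weight≡∑ []       = refl
    weight≡∑ {suc n} (a ∷ as) = trans (ℤ.pos-+ (nonzero a) (weight as))
      (trans (+-congʳ (+ nonzero a) (weight≡∑ as)) (sym (∑-coordinates n (λ k → + nonzero (lookup (a ∷ as) k)))))

    -- `V` contains a representative of `g`. This replaces the uncontrolled value `f x` by a sum
    -- over all values, which no longer depends on `f`.
    term≤∑V : ∀ (F : Carrier → ℤ) → (∀ {g h} → g ≈ h → F g ≡ F h) → (∀ g → 0ℤ ≤ F g) → ∀ g → F g ≤ ∑ V F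
    term≤∑V F F-cong 0≤F g = ℤ.≤-trans
      (ℤ.≤-reflexive (sym (trans (∑-*ʳ V (F g) (χ g)) (trans (cong (_* F g) (∑V-χ g)) (ℤ.*-identityˡ (F g))))))
      (∑-mono V bound)
      where
      bound : ∀ v → χ g v * F g ≤ F v
      bound v with g ≟ v
      ... | no _    = 0≤F v
      ... | yes g≈v = ℤ.≤-reflexive (trans (ℤ.*-identityˡ (F g)) (F-cong g≈v))

    module SecondMoment {n : ℕ} (f : Vec Bool n → Carrier) (Ps : List (Coeffs n)) where
      N L : ℤ
      N = 2^ n
      L = ∣ Ps ∣

      count : Vec Bool n → Carrier → ℤ
      count x = hits Ps (λ P → eval P x)

      mean : Carrier → ℤ
      mean v = ∑ Ps (λ P → hits (cube n) (eval P) v)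

      -- Scaled by `N` to stay integral, since `mean v` is `N` times the average of `count x v`.
      deviation : Vec Bool n → Carrier → ℤ
      deviation x v = N * count x v - mean v

      overlaps : ℤ
      overlaps = ∑ Ps (λ P → ∑ Ps (λ Q → common (proj₂ P) (proj₂ Q)))

      count-total : ∀ v → ∑ (cube n) (λ x → count x v) ≡ mean v
      count-total v = ∑-swap (cube n) Ps (λ x P → χ (eval P x) v)

      count² : ∑ V (λ v → ∑ (cube n) (λ x → count x v * count x v)) ≡ ∑ Ps (λ P → ∑ Ps (meet P))
      count² = begin
        ∑ V (λ v → ∑ (cube n) (λ x → count x v * count x v))
          ≡⟨ ∑-swap V (cube n) (λ v x → count x v * count x v) ⟩
        ∑ (cube n) (λ x → ∑ V (λ v → count x v * count x v))
          ≡⟨ ∑-cong (cube n) (λ x → ∑-hits Ps Ps (λ P → eval P x) (λ P → eval P x)) ⟩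
        ∑ (cube n) (λ x → ∑ Ps (λ P → ∑ Ps (λ Q → χ (eval P x) (eval Q x))))
          ≡⟨ ∑-swap (cube n) Ps (λ x P → ∑ Ps (λ Q → χ (eval P x) (eval Q x))) ⟩
        ∑ Ps (λ P → ∑ (cube n) (λ x → ∑ Ps (λ Q → χ (eval P x) (eval Q x))))
          ≡⟨ ∑-cong Ps (λ P → ∑-swap (cube n) Ps (λ x Q → χ (eval P x) (eval Q x))) ⟩
        ∑ Ps (λ P → ∑ Ps (meet P)) ∎
        where open ≡-Reasoning

      mean² : ∑ V (λ v → mean v * mean v) ≡ ∑ Ps (λ P → ∑ Ps (cross P))
      mean² = begin
        ∑ V (λ v → mean v * mean v)
          ≡⟨ ∑-cong V (λ v → ∑-product Ps Ps (λ P → h P v) (λ P → h P v)) ⟩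
        ∑ V (λ v → ∑ Ps (λ P → ∑ Ps (λ Q → h P v * h Q v)))
          ≡⟨ ∑-swap V Ps (λ v P → ∑ Ps (λ Q → h P v * h Q v)) ⟩
        ∑ Ps (λ P → ∑ V (λ v → ∑ Ps (λ Q → h P v * h Q v)))
          ≡⟨ ∑-cong Ps (λ P → ∑-swap V Ps (λ v Q → h P v * h Q v)) ⟩
        ∑ Ps (λ P → ∑ Ps (λ Q → ∑ V (λ v → h P v * h Q v)))
          ≡⟨ ∑-cong Ps (λ P → ∑-cong Ps (λ Q → ∑-hits (cube n) (cube n) (eval P) (eval Q))) ⟩
        ∑ Ps (λ P → ∑ Ps (cross P)) ∎
        where
        open ≡-Reasoning
        h : Coeffs n → Carrier → ℤ
        h P = hits (cube n) (eval P)

      -- For each value, the variance is the second moment minus the squared mean. Summation over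
      -- values turns these into coincidences at a common point (`meet`) and at two independent
      -- points (`cross`).
      variance≡ : ∑ V (λ v → ∑ (cube n) (λ x → deviation x v * deviation x v)) ≡
                  (N * N) * ∑ Ps (λ P → ∑ Ps (meet P)) - N * ∑ Ps (λ P → ∑ Ps (cross P))
      variance≡ = begin
        ∑ V (λ v → ∑ (cube n) (λ x → deviation x v * deviation x v))
          ≡⟨ ∑-cong V column ⟩
        ∑ V (λ v → (N * N) * C v + (ℤ.- N) * (mean v * mean v))
          ≡⟨ ∑-+ V (λ v → (N * N) * C v) (λ v → (ℤ.- N) * (mean v * mean v)) ⟩
        ∑ V (λ v → (N * N) * C v) + ∑ V (λ v → (ℤ.- N) * (mean v * mean v))
          ≡⟨ cong₂ _+_ (∑-* V (N * N) C) (∑-* V (ℤ.- N) (λ v → mean v * mean v)) ⟩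
        (N * N) * ∑ V C + (ℤ.- N) * ∑ V (λ v → mean v * mean v)
          ≡⟨ cong₂ (λ x y → (N * N) * x + (ℤ.- N) * y) count² mean² ⟩
        (N * N) * ∑ Ps (λ P → ∑ Ps (meet P)) + (ℤ.- N) * ∑ Ps (λ P → ∑ Ps (cross P))
          ≡⟨ neg N (∑ Ps (λ P → ∑ Ps (meet P))) (∑ Ps (λ P → ∑ Ps (cross P))) ⟩
        (N * N) * ∑ Ps (λ P → ∑ Ps (meet P)) - N * ∑ Ps (λ P → ∑ Ps (cross P)) ∎
        where
        open ≡-Reasoning
        C : Carrier → ℤ
        C v = ∑ (cube n) (λ x → count x v * count x v)
        neg : ∀ N x y → (N * N) * x + (ℤ.- N) * y ≡ (N * N) * x - N * y
        neg = solve-∀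
        expand : ∀ N c μ → (N * c - μ) * (N * c - μ) ≡ (N * N) * (c * c) + ((ℤ.- (+ 2 * (N * μ))) * c + μ * μ)
        expand = solve-∀
        collect : ∀ N C μ → (N * N) * C + ((ℤ.- (+ 2 * (N * μ))) * μ + N * (μ * μ)) ≡ (N * N) * C + (ℤ.- N) * (μ * μ)
        collect = solve-∀
        column : ∀ v → ∑ (cube n) (λ x → deviation x v * deviation x v) ≡ (N * N) * C v + (ℤ.- N) * (mean v * mean v)
        column v = begin
          ∑ (cube n) (λ x → deviation x v * deviation x v)
            ≡⟨ ∑-cong (cube n) (λ x → expand N (count x v) (mean v)) ⟩
          ∑ (cube n) (λ x → (N * N) * (count x v * count x v) + (β * count x v + mean v * mean v))
            ≡⟨ ∑-+ (cube n) (λ x → (N * N) * (count x v * count x v)) (λ x → β * count x v + mean v * mean v) ⟩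
          ∑ (cube n) (λ x → (N * N) * (count x v * count x v)) + ∑ (cube n) (λ x → β * count x v + mean v * mean v)
            ≡⟨ cong₂ _+_ (∑-* (cube n) (N * N) (λ x → count x v * count x v))
                 (trans (∑-+ (cube n) (λ x → β * count x v) (λ _ → mean v * mean v)) (cong₂ _+_
                   (trans (∑-* (cube n) β (λ x → count x v)) (cong (β *_) (count-total v)))
                   (trans (∑-const (cube n) (mean v * mean v)) (cong (_* (mean v * mean v)) (∣cube∣ n))))) ⟩
          (N * N) * C v + (β * mean v + N * (mean v * mean v))
            ≡⟨ collect N (C v) (mean v) ⟩
          (N * N) * C v + (ℤ.- N) * (mean v * mean v) ∎
          where β = ℤ.- (+ 2 * (N * mean v))

      covariance : N * ∑ Ps (λ P → ∑ Ps (meet P)) ≤ ∑ Ps (λ P → ∑ Ps (cross P)) + (N * N) * overlaps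
      covariance = subst₂ _≤_
        (trans (∑-cong Ps (λ P → ∑-* Ps N (meet P))) (∑-* Ps N (λ P → ∑ Ps (meet P))))
        (trans (∑-cong Ps (λ P → trans (∑-+ Ps (cross P) (λ Q → (N * N) * common (proj₂ P) (proj₂ Q)))
                 (+-congʳ (∑ Ps (cross P)) (∑-* Ps (N * N) (λ Q → common (proj₂ P) (proj₂ Q))))))
          (trans (∑-+ Ps (λ P → ∑ Ps (cross P)) (λ P → (N * N) * ∑ Ps (λ Q → common (proj₂ P) (proj₂ Q))))
            (+-congʳ (∑ Ps (λ P → ∑ Ps (cross P))) (∑-* Ps (N * N) (λ P → ∑ Ps (λ Q → common (proj₂ P) (proj₂ Q)))))))
        (∑-mono Ps (λ P → ∑-mono Ps (λ Q → independence P Q)))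

      deviation-cong : ∀ x {g h} → g ≈ h → deviation x g ≡ deviation x h
      deviation-cong x e = cong₂ (λ c μ → N * c - μ) (∑-cong Ps (λ P → χ-cong ≈-refl e))
        (∑-cong Ps (λ P → ∑-cong (cube n) (λ y → χ-cong ≈-refl e)))

      U Q : ℤ
      U = ∑ (cube n) (λ x → deviation x (f x))
      Q = ∑ (cube n) (λ x → deviation x (f x) * deviation x (f x))

      -- The square at `f x` is at most the sum of the squares over all values, and only pairs with
      -- a common variable contribute to the bound on the total variance.
      Q≤ : Q ≤ N * ((N * N) * overlaps)
      Q≤ = ℤ.≤-trans (∑-mono (cube n) (λ x → term≤∑V (λ v → deviation x v * deviation x v)
               (λ e → cong (λ z → z * z) (deviation-cong x e)) (λ v → 0≤square (deviation x v)) (f x)))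
        (ℤ.≤-trans (ℤ.≤-reflexive (trans (∑-swap (cube n) V (λ x v → deviation x v * deviation x v)) variance≡))
          (≤-by _ (0≤2^ n ⊗ gap covariance) (identity N (∑ Ps (λ P → ∑ Ps (meet P))) (∑ Ps (λ P → ∑ Ps (cross P))) overlaps)))
        where
        identity : ∀ N z c o → N * ((N * N) * o) ≡ (N * N) * z - N * c + N * (c + (N * N) * o - N * z)
        identity = solve-∀

      frequency : Fin n → ℤ
      frequency k = ∑ Ps (λ P → + nonzero (lookup (proj₂ P) k))

      overlaps≡ : overlaps ≡ ∑ (coordinates n) (λ k → frequency k * frequency k)
      overlaps≡ = begin
        ∑ Ps (λ P → ∑ Ps (λ Q → ∑ ks (λ k → s k P * s k Q)))
          ≡⟨ ∑-cong Ps (λ P → ∑-swap Ps ks (λ Q k → s k P * s k Q)) ⟩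
        ∑ Ps (λ P → ∑ ks (λ k → ∑ Ps (λ Q → s k P * s k Q)))
          ≡⟨ ∑-swap Ps ks (λ P k → ∑ Ps (λ Q → s k P * s k Q)) ⟩
        ∑ ks (λ k → ∑ Ps (λ P → ∑ Ps (λ Q → s k P * s k Q)))
          ≡⟨ ∑-cong ks (λ k → sym (∑-product Ps Ps (s k) (s k))) ⟩
        ∑ ks (λ k → frequency k * frequency k) ∎
        where
        open ≡-Reasoning
        ks = coordinates n
        s : Fin n → Coeffs n → ℤ
        s k P = + nonzero (lookup (proj₂ P) k)

      module _ (m : ℕ) (good : All (Good m f) Ps) (nonconstant : All (λ P → 1 ℕ.≤ weight (proj₂ P)) Ps) where
        M T : ℤ
        M = + m
        T = ∑ (cube n) (λ x → count x (f x))

        T≥ : L * (N * (M + + 2)) ≤ (+ 2 * M) * T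
        T≥ = subst (λ t → L * (N * (M + + 2)) ≤ (+ 2 * M) * t)
          (∑-cong (cube n) (λ x → ∑-cong Ps (λ P → χ-sym (f x) (eval P x)))) (agreement-total m f good)

        mean≤ : ∀ v → + 2 * mean v ≤ L * N
        mean≤ v = subst₂ _≤_ (∑-* Ps (+ 2) (λ P → hits (cube n) (eval P) v)) (∑-const Ps N)
          (∑-mono-All (All.map (λ {P} 1≤ → half-concentration P 1≤ v) nonconstant))

        U≡ : U ≡ N * T - ∑ (cube n) (λ x → mean (f x))
        U≡ = trans (∑-cong (cube n) (λ x → split N (count x (f x)) (mean (f x))))
          (trans (∑-+ (cube n) (λ x → N * count x (f x)) (λ x → ℤ.- 1ℤ * mean (f x)))
            (trans (cong₂ _+_ (∑-* (cube n) N (λ x → count x (f x))) (∑-* (cube n) (ℤ.- 1ℤ) (λ x → mean (f x))))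
              (sym (split N T (∑ (cube n) (λ x → mean (f x)))))))
          where
          split : ∀ N c μ → N * c - μ ≡ N * c + ℤ.- 1ℤ * μ
          split = solve-∀

        means≤ : + 2 * ∑ (cube n) (λ x → mean (f x)) ≤ N * (L * N)
        means≤ = subst₂ _≤_ (∑-* (cube n) (+ 2) (λ x → mean (f x)))
          (trans (∑-const (cube n) (L * N)) (cong (_* (L * N)) (∣cube∣ n))) (∑-mono (cube n) (λ x → mean≤ (f x)))

        -- The count at `f x` averages at least `L(1/2 + 1/m)`, while nonconstant polynomials have
        -- mean at most `L/2` at every value. The average deviation is therefore at least `L/m`.
        U≥ : L * (N * N) ≤ M * U
        U≥ = cancel-≤ (+ 2) (≤-by _ (0≤2^ n ⊗ gap T≥ ⊕ 0≤+ m ⊗ gap means≤)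
          (trans (cong (λ u → + 2 * (M * u)) U≡) (identity L N M T (∑ (cube n) (λ x → mean (f x))))))
          where
          identity : ∀ L N M T S → + 2 * (M * (N * T - S)) ≡ + 2 * (L * (N * N)) +
            (N * ((+ 2 * M) * T - L * (N * (M + + 2))) + M * (N * (L * N) - + 2 * S))
          identity = solve-∀

        -- Cauchy-Schwarz converts the average deviation into a lower bound on `Q`, which `Q≤`
        -- compares with the overlaps; four powers of `N` cancel.
        many-overlaps : L * L ≤ (M * M) * overlaps
        many-overlaps = cancelN (cancelN (cancelN (cancelN
            (≤-by _ (gap (square-mono (0≤+ (length Ps) ⊗ 0≤square N) U≥) ⊕
                     (0≤square M ⊗ gap cauchy ⊕ 0≤square M ⊗ 0≤2^ n ⊗ gap Q≤)) (identity L N M U Q overlaps)))))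
          where
          cancelN : ∀ {a b} → N * a ≤ N * b → a ≤ b
          cancelN = cancel-≤ N {{2^-positive n}}
          cauchy : U * U ≤ N * Q
          cauchy = subst (λ l → U * U ≤ l * Q) (∣cube∣ n) (∑-cauchy (cube n) (λ x → deviation x (f x)))
          identity : ∀ L N M U Q o → N * (N * (N * (N * ((M * M) * o)))) ≡ N * (N * (N * (N * (L * L)))) +
            ((M * U) * (M * U) - (L * (N * N)) * (L * (N * N)) +
             ((M * M) * (N * Q - U * U) + (M * M) * N * (N * ((N * N) * o) - Q)))
          identity = solve-∀

        -- `overlaps` is the sum of the squared frequencies, while the frequencies sum to the total
        -- weight, at most `w` per polynomial. So `popular` applies with `M * M` as its second
        -- parameter.
        popular-coordinate : ∀ w .{{_ : ℕ.NonZero w}} .{{_ : ℤ.Positive ∣ Ps ∣}} → All (λ P → weight (proj₂ P) ℕ.≤ w) Ps →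
                             ∃ λ k → ∣ Ps ∣ ≤ (+ w * (+ m * + m)) * frequency k
        popular-coordinate w@(suc _) light = Any.satisfied (popular (coordinates n) frequency L (M * M) (+ w)
          (λ k → ∑-nonneg Ps (λ P → 0≤+ (nonzero (lookup (proj₂ P) k))))
          (subst (λ o → L * L ≤ (M * M) * o) overlaps≡ many-overlaps) total)
          where
          total : ∑ (coordinates n) frequency ≤ + w * L
          total = subst₂ _≤_
            (trans (∑-cong Ps (λ P → weight≡∑ (proj₂ P))) (∑-swap Ps (coordinates n) (λ P k → + nonzero (lookup (proj₂ P) k))))
            (trans (∑-const Ps (+ w)) (ℤ.*-comm L (+ w))) (∑-mono-All (All.map +≤+ light))

    -- Coefficientwise equality and multiplicities.

    infix 4 _≋_ _≋?_
    _≋_ : ∀ {n} → Coeffs n → Coeffs n → Set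
    P ≋ Q = proj₁ P ≈ proj₁ Q × ∀ k → lookup (proj₂ P) k ≈ lookup (proj₂ Q) k

    _≋?_ : ∀ {n} (P Q : Coeffs n) → Dec (P ≋ Q)
    P ≋? Q = (proj₁ P ≟ proj₁ Q) ×-dec Fin.all? (λ k → lookup (proj₂ P) k ≟ lookup (proj₂ Q) k)

    ≋-sym : ∀ {n} (P Q : Coeffs n) → P ≋ Q → Q ≋ P
    ≋-sym _ _ (p , ps) = ≈-sym p , λ k → ≈-sym (ps k)

    ≋-trans : ∀ {n} (P Q R : Coeffs n) → P ≋ Q → Q ≋ R → P ≋ R
    ≋-trans _ _ _ (p , ps) (q , qs) = ≈-trans p q , λ k → ≈-trans (ps k) (qs k)

    linSum-cong : ∀ {n} (as bs : Vec Carrier n) → (∀ k → lookup as k ≈ lookup bs k) → ∀ x → linSum as x ≈ linSum bs x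
    linSum-cong []       []       e []          = ≈-refl
    linSum-cong (a ∷ as) (b ∷ bs) e (true ∷ x)  = ∙-cong (e zero) (linSum-cong as bs (λ k → e (suc k)) x)
    linSum-cong (a ∷ as) (b ∷ bs) e (false ∷ x) = ∙-congˡ (linSum-cong as bs (λ k → e (suc k)) x)

    eval-cong : ∀ {n} {P Q : Coeffs n} → P ≋ Q → ∀ x → eval P x ≈ eval Q x
    eval-cong {P = _ , as} {_ , bs} (p , ps) x = ∙-cong p (linSum-cong as bs ps x)

    multiplicity : ∀ {n} → List (Coeffs n) → Coeffs n → ℤ
    multiplicity Ps Q = ∑ Ps (λ P → ind (P ≋? Q))

    -- Restriction can identify distinct polynomials, so the induction carries a multiplicity instead of distinctness.
    Multiplicity≤ : ∀ {n} → ℤ → List (Coeffs n) → Set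
    Multiplicity≤ μ Ps = ∀ Q → multiplicity Ps Q ≤ μ

    multiplicity-filter : ∀ {n μ} {R : Pred (Coeffs n) 0ℓ} (R? : Decidable₁ R) Ps →
                          Multiplicity≤ μ Ps → Multiplicity≤ μ (filter R? Ps)
    multiplicity-filter R? Ps mult Q = ℤ.≤-trans (ℤ.≤-reflexive (∑-filter R? Ps (λ P → ind (P ≋? Q))))
      (ℤ.≤-trans (∑-mono Ps (λ P → drop (R? P) (P ≋? Q))) (mult Q))
      where
      drop : ∀ {X Y : Set} (d : Dec X) (e : Dec Y) → ind d * ind e ≤ ind e
      drop (yes _) e = ℤ.≤-reflexive (ℤ.*-identityˡ (ind e))
      drop (no _)  e = 0≤ind e

    -- Every entry equals the first one, so the multiplicity of the first counts them all.
    collapse : ∀ {n μ} {R : Pred (Coeffs n) 0ℓ} → (∀ P Q → R P → R Q → P ≋ Q) → 0ℤ ≤ μ →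
               ∀ {Ps} → All R Ps → Multiplicity≤ μ Ps → ∣ Ps ∣ ≤ μ
    collapse unique 0≤μ []                         mult = 0≤μ
    collapse unique 0≤μ {Ps@(P₀ ∷ _)} rs@(r₀ ∷ _) mult = ℤ.≤-trans (ℤ.≤-reflexive (∣ Ps ∣≡∑1))
      (ℤ.≤-trans (∑-mono-All (All.map (λ {P} r → ℤ.≤-reflexive (sym (ind-yes (P ≋? P₀) (unique P P₀ r r₀)))) rs)) (mult P₀))

    nonzero≡0 : ∀ a → nonzero a ≡ 0 → a ≈ ε
    nonzero≡0 a e with a ≟ ε
    ... | yes a≈ε = a≈ε

    weight≡0 : ∀ {n} (as : Vec Carrier n) → weight as ≡ 0 → ∀ k → lookup as k ≈ ε
    weight≡0 (a ∷ as) e zero    = nonzero≡0 a (ℕ.m+n≡0⇒m≡0 (nonzero a) e)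
    weight≡0 (a ∷ as) e (suc k) = weight≡0 as (ℕ.m+n≡0⇒n≡0 (nonzero a) e) k

    linSum-ε : ∀ {n} (as : Vec Carrier n) → (∀ k → lookup as k ≈ ε) → ∀ x → linSum as x ≈ ε
    linSum-ε []       e []          = ≈-refl
    linSum-ε (a ∷ as) e (true ∷ x)  = ≈-trans (∙-cong (e zero) (linSum-ε as (λ k → e (suc k)) x)) (identityˡ ε)
    linSum-ε (a ∷ as) e (false ∷ x) = ≈-trans (∙-congˡ (linSum-ε as (λ k → e (suc k)) x)) (identityˡ ε)

    -- Different constants have disjoint agreement sets, and two subsets of density above 1/2 cannot
    -- be disjoint.
    good-constants-equal : ∀ {n m} (f : Vec Bool n → Carrier) (P Q : Coeffs n) →
      (weight (proj₂ P) ≡ 0 × Good m f P) → (weight (proj₂ Q) ≡ 0 × Good m f Q) → P ≋ Q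
    good-constants-equal {n} {m} f P@(c , as) Q@(d , bs) (p , good) (q , good') with c ≟ d
    ... | yes c≈d = c≈d , λ k → ≈-trans (weight≡0 as p k) (≈-sym (weight≡0 bs q k))
    ... | no c≉d = contradiction (cancel-≤ N {{2^-positive n}} impossible) λ { (+≤+ ()) }
      where
      N = 2^ n
      exclusive : ∀ x → χ (f x) (eval P x) + χ (f x) (eval Q x) ≤ 1ℤ
      exclusive x with f x ≟ eval P x | f x ≟ eval Q x
      ... | no _  | no _  = 0≤+ 1
      ... | yes _ | no _  = ℤ.≤-refl
      ... | no _  | yes _ = ℤ.≤-refl
      ... | yes u | yes v = contradiction
        (≈-trans (≈-sym (constant c as p)) (≈-trans (≈-sym u) (≈-trans v (constant d bs q)))) c≉d
        where
        constant : ∀ c as → weight as ≡ 0 → c ∙ linSum as x ≈ c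
        constant c as p = ≈-trans (∙-congˡ (linSum-ε as (weight≡0 as p) x)) (identityʳ c)
      total : agreement f P + agreement f Q ≤ N
      total = ℤ.≤-trans (ℤ.≤-reflexive (sym (∑-+ (cube n) (λ x → χ (f x) (eval P x)) (λ x → χ (f x) (eval Q x)))))
        (ℤ.≤-trans (∑-mono (cube n) exclusive) (ℤ.≤-reflexive (∑-cube-1 n)))
      identity : ∀ N M a b → N * 0ℤ ≡ N * + 4 +
        (((+ 2 * M) * a - N * (M + + 2)) + ((+ 2 * M) * b - N * (M + + 2)) + (+ 2 * M) * (N - (a + b)))
      identity = solve-∀
      impossible : N * + 4 ≤ N * 0ℤ
      impossible = ≤-by _ (gap good ⊕ gap good' ⊕ (0≤+ 2 ⊗ 0≤+ m) ⊗ gap total) (identity N (+ m) (agreement f P) (agreement f Q))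

    -- Restriction to a face of the cube.

    part : Bool → Carrier → Carrier
    part b a = if b then a else ε

    -- The variable remains with coefficient `ε`, keeping `n` fixed, and its contribution moves into
    -- the constant term.
    restrict : ∀ {n} → Fin n → Bool → Coeffs n → Coeffs n
    restrict k b (c , as) = c ∙ part b (lookup as k) , as [ k ]≔ ε

    linSum-restrict : ∀ {n} k b (as : Vec Carrier n) x → part b (lookup as k) ∙ linSum (as [ k ]≔ ε) x ≈ linSum as (x [ k ]≔ b)
    linSum-restrict zero    b (a ∷ as) (true ∷ x)  = ∙-congˡ (identityˡ _)
    linSum-restrict zero    b (a ∷ as) (false ∷ x) = ∙-congˡ (identityˡ _)
    linSum-restrict (suc k) b (a ∷ as) (y ∷ x)     =
      ≈-trans (x∙yz≈y∙xz _ _ _) (∙-congˡ (linSum-restrict k b as x))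

    eval-restrict : ∀ {n} k b (P : Coeffs n) x → eval (restrict k b P) x ≈ eval P (x [ k ]≔ b)
    eval-restrict k b (c , as) x = ≈-trans (assoc c _ _) (∙-congˡ (linSum-restrict k b as x))

    weight-restrict : ∀ {n} k (as : Vec Carrier n) → nonzero (lookup as k) ≡ 1 → suc (weight (as [ k ]≔ ε)) ≡ weight as
    weight-restrict zero    (a ∷ as) e = trans (cong (λ z → suc (z ℕ.+ weight as)) (nonzero-yes ≈-refl)) (cong (ℕ._+ weight as) (sym e))
    weight-restrict (suc k) (a ∷ as) e = trans (sym (ℕ.+-suc (nonzero a) _)) (cong (nonzero a ℕ.+_) (weight-restrict k as e))

    -- Equal restrictions to one face leave only a constant difference on the other face, and
    -- agreement at the single point `x` removes it. The two constant terms then determine `c` and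
    -- the coefficient at `k`.
    restrict-injective : ∀ {n} k b x (P Q : Coeffs n) → restrict k b P ≋ restrict k b Q →
                         eval (restrict k (not b) P) x ≈ eval (restrict k (not b) Q) x → P ≋ Q
    restrict-injective k b x P@(c , as) Q@(d , bs) (p , ps) e = c≈d , coefficients
      where
      other : c ∙ part (not b) (lookup as k) ≈ d ∙ part (not b) (lookup bs k)
      other = ∙-cancelʳ (linSum (as [ k ]≔ ε) x) _ _
        (≈-trans e (∙-congˡ (≈-sym (linSum-cong (as [ k ]≔ ε) (bs [ k ]≔ ε) ps x))))
      both : ∀ b → c ∙ part b (lookup as k) ≈ d ∙ part b (lookup bs k) →
             c ∙ part (not b) (lookup as k) ≈ d ∙ part (not b) (lookup bs k) →
             c ∙ ε ≈ d ∙ ε × c ∙ lookup as k ≈ d ∙ lookup bs k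
      both true  u v = v , u
      both false u v = u , v
      c≈d : c ≈ d
      c≈d = ∙-cancelʳ ε c d (proj₁ (both b p other))
      coefficients : ∀ j → lookup as j ≈ lookup bs j
      coefficients j with j Fin.≟ k
      ... | yes refl = ∙-cancelˡ c _ _ (≈-trans (proj₂ (both b p other)) (∙-congʳ (≈-sym c≈d)))
      ... | no j≢k   = ≈-trans (≈-reflexive (sym (lookup∘update′ j≢k as ε))) (≈-trans (ps j) (≈-reflexive (lookup∘update′ j≢k bs ε)))

    fix : ∀ {n} → Fin n → Bool → (Vec Bool n → Carrier) → Vec Bool n → Carrier
    fix k b f x = f (x [ k ]≔ b)

    agreement-restrict : ∀ {n} k (f : Vec Bool n → Carrier) P b →
      agreement (fix k b f) (restrict k b P) + agreement (fix k (not b) f) (restrict k (not b) P) ≡ agreement f P + agreement f P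
    agreement-restrict {n} k f P b = trans (cong₂ _+_ (side b) (side (not b))) (order b)
      where
      F : Vec Bool n → ℤ
      F x = χ (f x) (eval P x)
      side : ∀ b → agreement (fix k b f) (restrict k b P) ≡ ∑ (cube n) (λ x → F (x [ k ]≔ b))
      side b = ∑-cong (cube n) (λ x → χ-cong ≈-refl (eval-restrict k b P x))
      order : ∀ b → ∑ (cube n) (λ x → F (x [ k ]≔ b)) + ∑ (cube n) (λ x → F (x [ k ]≔ not b)) ≡ ∑ (cube n) F + ∑ (cube n) F
      order true  = ∑-update k F
      order false = trans (ℤ.+-comm (∑ (cube n) (λ x → F (x [ k ]≔ false))) _) (∑-update k F)

    Good? : ∀ {n} m (f : Vec Bool n → Carrier) → Decidable₁ (Good m f)
    Good? {n} m f P = (2^ n * (+ m + + 2)) ℤ.≤? ((+ 2 * + m) * agreement f P)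

    -- The agreement density is the average of those on the two faces, so at least one face does not
    -- fall below it.
    good-restrict : ∀ {n m} (f : Vec Bool n → Carrier) k {P} → Good m f P →
                    Good m (fix k true f) (restrict k true P) ⊎ Good m (fix k false f) (restrict k false P)
    good-restrict {n} {m} f k {P} good with Good? m (fix k true f) (restrict k true P)
    ... | yes g = inj₁ g
    ... | no ¬g = inj₂ (≤-by _ (0≤+ 2 ⊗ gap good ⊕ gap (ℤ.<⇒≤ (ℤ.≰⇒> ¬g)))
            (trans (isolate (+ 2 * + m) t u) (trans (cong (λ z → (+ 2 * + m) * z - (+ 2 * + m) * t) (agreement-restrict k f P true))
              (identity (+ 2 * + m) (2^ n * (+ m + + 2)) (agreement f P) t))))
      where
      t = agreement (fix k true f) (restrict k true P)
      u = agreement (fix k false f) (restrict k false P)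
      isolate : ∀ c t u → c * u ≡ c * (t + u) - c * t
      isolate = solve-∀
      identity : ∀ c b a t → c * (a + a) - c * t ≡ b + (+ 2 * (c * a - b) + (b - c * t))
      identity = solve-∀

    -- Polynomials with a common restriction to x_k = b take distinct values everywhere on x_k = 1 - b,
    -- where each of them still agrees with f with density at least 2/m.
    multiplicity-restrict : ∀ {n m μ} (f : Vec Bool n → Carrier) k b Ps → 0ℤ ≤ μ → All (Good m f) Ps →
                            Multiplicity≤ μ Ps → Multiplicity≤ (μ * + m) (map (restrict k b) Ps)
    multiplicity-restrict {n} {m} {μ} f k b Ps 0≤μ good mult R =
        subst (_≤ μ * M) (sym (trans (∑-map (restrict k b) Ps (λ P → ind (P ≋? R))) (sym (∣filter∣ same? Ps)))) Y≤
      where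
      N = 2^ n
      M = + m
      same? : Decidable₁ (λ P → restrict k b P ≋ R)
      same? P = restrict k b P ≋? R
      Y = filter same? Ps
      same : All (λ P → restrict k b P ≋ R) Y
      same = All.all-filter same? Ps
      there-agreement : Coeffs n → ℤ
      there-agreement P = agreement (fix k (not b) f) (restrict k (not b) P)
      -- The densities on the two faces sum to at least `1 + 2/m`, and the face `x_k = b` accounts
      -- for at most 1.
      large : ∀ {P} → Good m f P → + 2 * N ≤ M * there-agreement P
      large {P} g = ≤-by _ (gap g ⊕ 0≤+ m ⊗ gap (∑χ-cube≤ (fix k b f) (eval (restrict k b P))))
          (trans (isolate M here-agreement (there-agreement P)) (trans (cong (λ z → M * z - M * here-agreement) (agreement-restrict k f P b))
            (identity M N (agreement f P) here-agreement)))
        where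
        here-agreement = agreement (fix k b f) (restrict k b P)
        isolate : ∀ c t u → c * u ≡ c * (t + u) - c * t
        isolate = solve-∀
        identity : ∀ M N a t → M * (a + a) - M * t ≡ + 2 * N + (((+ 2 * M) * a - N * (M + + 2)) + M * (N - t))
        identity = solve-∀
      pointwise : ∀ x → ∑ Y (λ P → χ (fix k (not b) f x) (eval (restrict k (not b) P) x)) ≤ μ
      pointwise x = subst (_≤ μ) (∣filter∣ hit? Y) (collapse unique 0≤μ
          (All.zip (All.filter⁺ hit? same , All.all-filter hit? Y)) (multiplicity-filter hit? Y (multiplicity-filter same? Ps mult)))
        where
        hit? : Decidable₁ (λ P → fix k (not b) f x ≈ eval (restrict k (not b) P) x)
        hit? P = fix k (not b) f x ≟ eval (restrict k (not b) P) x
        unique : ∀ P Q → (restrict k b P ≋ R × _) → (restrict k b Q ≋ R × _) → P ≋ Q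
        unique P Q (p , u) (q , v) = restrict-injective k b x P Q
          (≋-trans (restrict k b P) R (restrict k b Q) p (≋-sym (restrict k b Q) R q)) (≈-trans (≈-sym u) v)
      total : ∑ Y there-agreement ≤ N * μ
      total = ℤ.≤-trans (ℤ.≤-reflexive (∑-swap Y (cube n) (λ P x → χ (fix k (not b) f x) (eval (restrict k (not b) P) x))))
        (ℤ.≤-trans (∑-mono (cube n) pointwise) (ℤ.≤-reflexive (trans (∑-const (cube n) μ) (cong (_* μ) (∣cube∣ n)))))
      summed : ∣ Y ∣ * (+ 2 * N) ≤ M * ∑ Y there-agreement
      summed = subst₂ _≤_ (∑-const Y (+ 2 * N)) (∑-* Y M there-agreement) (∑-mono-All (All.map (λ {P} → large {P}) (All.filter⁺ same? good)))
      Y≤ : ∣ Y ∣ ≤ μ * M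
      Y≤ = cancel-≤ N {{2^-positive n}} (≤-by _ (gap summed ⊕ 0≤+ m ⊗ gap total ⊕ 0≤2^ n ⊗ 0≤+ (length Y))
        (identity N M μ ∣ Y ∣ (∑ Y there-agreement)))
        where
        identity : ∀ N M μ y s → N * (μ * M) ≡ N * y + ((M * s - y * (+ 2 * N)) + M * (N * μ - s) + N * y)
        identity = solve-∀

    -- Induction on the number of nonzero coefficients.

    -- Quantified over `f` and `μ` because the induction replaces `f` by a restriction and
    -- multiplies `μ` by `m`.
    SparseBound : ℕ → ℕ → ℕ → ℤ → Set
    SparseBound n m w B = ∀ μ (f : Vec Bool n → Carrier) Ps → 0ℤ ≤ μ → Multiplicity≤ μ Ps → All (Good m f) Ps →
      All (λ P → weight (proj₂ P) ℕ.≤ w) Ps → ∣ Ps ∣ ≤ μ * B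

    module Restriction {n : ℕ} (m w : ℕ) (B : ℤ) (bound : SparseBound n m w B) (μ : ℤ) (0≤μ : 0ℤ ≤ μ)
      (f : Vec Bool n → Carrier) (Ps : List (Coeffs n)) (mult : Multiplicity≤ μ Ps)
      (good : All (Good m f) Ps) (light : All (λ P → weight (proj₂ P) ℕ.≤ suc w) Ps) (k : Fin n) where

      involves? : Decidable₁ (λ (P : Coeffs n) → nonzero (lookup (proj₂ P) k) ≡ 1)
      involves? P = nonzero (lookup (proj₂ P) k) ℕ.≟ 1

      involving : List (Coeffs n)
      involving = filter involves? Ps

      good? : ∀ b → Decidable₁ (λ P → Good m (fix k b f) (restrict k b P))
      good? b P = Good? m (fix k b f) (restrict k b P)

      side : Bool → List (Coeffs n)
      side b = filter (good? b) involving

      frequency≡ : SecondMoment.frequency f Ps k ≡ ∣ involving ∣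
      frequency≡ = trans (∑-cong Ps (λ P → value (lookup (proj₂ P) k))) (sym (∣filter∣ involves? Ps))
        where
        value : ∀ a → + nonzero a ≡ ind (nonzero a ℕ.≟ 1)
        value a with a ≟ ε
        ... | yes _ = refl
        ... | no _  = refl

      involving≤ : ∣ involving ∣ ≤ ∣ side true ∣ + ∣ side false ∣
      involving≤ = ∣∣≤ (good? true) (good? false) (All.map (λ {P} g → good-restrict {m = m} f k {P} g) (All.filter⁺ involves? good))

      -- Fixing a variable that occurs lowers the weight by one, so the induction hypothesis applies
      -- on the face where the agreement survives, with multiplicity `μ * + m`.
      side≤ : ∀ b → ∣ side b ∣ ≤ (μ * + m) * B
      side≤ b = subst (λ l → + l ≤ (μ * + m) * B) (length-map (restrict k b) (side b))
        (bound (μ * + m) (fix k b f) (map (restrict k b) (side b)) (0≤μ ⊗ 0≤+ m)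
          (multiplicity-restrict {m = m} f k b (side b) 0≤μ (All.filter⁺ (good? b) (All.filter⁺ involves? good))
            (multiplicity-filter (good? b) involving (multiplicity-filter involves? Ps mult)))
          (All.map⁺ (All.all-filter (good? b) involving))
          (All.map⁺ (All.map (λ {P} (e , l) → ℕ.s≤s⁻¹ (subst (ℕ._≤ suc w) (sym (weight-restrict k (proj₂ P) e)) l))
            (All.filter⁺ (good? b) (All.zip (All.all-filter involves? Ps , All.filter⁺ involves? light))))))

      frequency≤ : SecondMoment.frequency f Ps k ≤ + 2 * ((μ * + m) * B)
      frequency≤ = ℤ.≤-trans (ℤ.≤-reflexive frequency≡) (ℤ.≤-trans involving≤
        (ℤ.≤-trans (ℤ.+-mono-≤ (side≤ true) (side≤ false)) (ℤ.≤-reflexive (identity ((μ * + m) * B)))))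
        where
        identity : ∀ x → x + x ≡ + 2 * x
        identity = solve-∀

    -- The list is at most `suc w` times `m` squared times the frequency of a popular variable,
    -- which `frequency≤` bounds through its two faces. The empty list is split off because the
    -- choice of that variable needs positive length.
    nonconstant-list : ∀ {n} m w B → 0ℤ ≤ B → SparseBound n m w B → ∀ μ (f : Vec Bool n → Carrier) Ps → 0ℤ ≤ μ →
      Multiplicity≤ μ Ps → All (Good m f) Ps → All (λ P → weight (proj₂ P) ℕ.≤ suc w) Ps →
      All (λ P → 1 ℕ.≤ weight (proj₂ P)) Ps → ∣ Ps ∣ ≤ μ * ((+ 2 * + suc w * (+ m * + m * + m)) * B)
    nonconstant-list m w B 0≤B bound μ f [] 0≤μ mult good light nonconstant =
        nonneg μ (+ m) (+ suc w) B 0≤μ (0≤+ m) (0≤+ (suc w)) 0≤B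
    nonconstant-list {n} m w B 0≤B bound μ f (P ∷ Ps) = nonempty (P ∷ Ps)
      where
      nonempty : ∀ Ps → .{{ℤ.Positive ∣ Ps ∣}} → 0ℤ ≤ μ → Multiplicity≤ μ Ps → All (Good m f) Ps →
        All (λ P → weight (proj₂ P) ℕ.≤ suc w) Ps → All (λ P → 1 ℕ.≤ weight (proj₂ P)) Ps →
        ∣ Ps ∣ ≤ μ * ((+ 2 * + suc w * (+ m * + m * + m)) * B)
      nonempty Ps 0≤μ mult good light nonconstant =
        combine μ (+ m) (+ suc w) B (SecondMoment.frequency f Ps (proj₁ chosen)) (∣ Ps ∣) (0≤+ m) (0≤+ (suc w)) (proj₂ chosen)
          (Restriction.frequency≤ m w B bound μ 0≤μ f Ps mult good light (proj₁ chosen))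
        where
        chosen : ∃ λ k → ∣ Ps ∣ ≤ (+ suc w * (+ m * + m)) * SecondMoment.frequency f Ps k
        chosen = SecondMoment.popular-coordinate f Ps m good nonconstant (suc w) light

    -- All good constants coincide, so they contribute at most `μ`; the remaining polynomials are
    -- covered by `nonconstant-list` with the bound for smaller weight.
    sparse-list : ∀ {n} m w → SparseBound n m w (sparseBound (+ m) w)
    sparse-list m zero μ f Ps 0≤μ mult good light = ℤ.≤-trans
      (collapse (good-constants-equal {m = m} f) 0≤μ (All.zip (All.map ℕ.n≤0⇒n≡0 light , good)) mult)
      (ℤ.≤-reflexive (sym (ℤ.*-identityʳ μ)))
    sparse-list m (suc w) μ f Ps 0≤μ mult good light = ℤ.≤-trans
        (∣∣≤ constant? nonconstant? (All.universal (λ P → dichotomy (weight (proj₂ P))) Ps))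
        (ℤ.≤-trans (ℤ.+-mono-≤ constants others) (ℤ.≤-reflexive (identity μ rest)))
      where
      rest = (+ 2 * + suc w * (+ m * + m * + m)) * sparseBound (+ m) w
      constant? : Decidable₁ (λ P → weight (proj₂ P) ≡ 0)
      constant? P = weight (proj₂ P) ℕ.≟ 0
      nonconstant? : Decidable₁ (λ P → 1 ℕ.≤ weight (proj₂ P))
      nonconstant? P = 1 ℕ.≤? weight (proj₂ P)
      dichotomy : ∀ k → k ≡ 0 ⊎ 1 ℕ.≤ k
      dichotomy zero    = inj₁ refl
      dichotomy (suc k) = inj₂ (s≤s z≤n)
      constants : ∣ filter constant? Ps ∣ ≤ μ
      constants = collapse (good-constants-equal {m = m} f) 0≤μ
        (All.zip (All.all-filter constant? Ps , All.filter⁺ constant? good)) (multiplicity-filter constant? Ps mult)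
      others : ∣ filter nonconstant? Ps ∣ ≤ μ * rest
      others = nonconstant-list m w (sparseBound (+ m) w) (0≤sparseBound m w) (sparse-list m w) μ f (filter nonconstant? Ps) 0≤μ
        (multiplicity-filter nonconstant? Ps mult)
        (All.filter⁺ nonconstant? good) (All.filter⁺ nonconstant? light) (All.all-filter nonconstant? Ps)
      identity : ∀ μ x → μ + μ * x ≡ μ * (1ℤ + x)
      identity = solve-∀

    -- Translation to the origin and the bound for the whole list.

    translate : ∀ {n} → (Vec Bool n → Carrier) → Coeffs n → Vec Bool n → Carrier
    translate f P x = f x ∙ eval P x ⁻¹

    agreement-translate : ∀ {n} (f : Vec Bool n → Carrier) P Q → agreement (translate f P) (Q ⊖ P) ≡ agreement f Q
    agreement-translate {n} f P Q = ∑-cong (cube n) (λ x →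
      trans (χ-cong ≈-refl (eval-⊖ Q P x)) (χ-cancelʳ (f x) (eval Q x) (eval P x ⁻¹)))

    good-translate : ∀ {n m} (f : Vec Bool n → Carrier) P Q → Good m f Q → Good m (translate f P) (Q ⊖ P)
    good-translate {n} {m} f P Q = subst (λ a → 2^ n * (+ m + + 2) ≤ (+ 2 * + m) * a) (sym (agreement-translate f P Q))

    -- Two translates with the same coefficients define the same function, and undoing the
    -- translation would make the originals equal as functions.
    multiplicity-translate : ∀ {n} P (Qs : List (Coeffs n)) → AllPairs DistinctFn Qs → Multiplicity≤ 1ℤ (map (_⊖ P) Qs)
    multiplicity-translate P Qs distinct R = subst (_≤ 1ℤ) (sym (∑-map (_⊖ P) Qs (λ Q → ind (Q ≋? R))))
      (∑-exclusive (λ Q → (Q ⊖ P) ≋? R) (AllPairs.map (λ {Q} {Q'} ne p q → ne (λ x →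
        ∙-cancelʳ (eval P x ⁻¹) (eval Q x) (eval Q' x) (≈-trans (≈-sym (eval-⊖ Q P x)) (≈-trans (eval-cong {P = Q ⊖ P} {R} p x)
          (≈-trans (≈-sym (eval-cong {P = Q' ⊖ P} {R} q x)) (eval-⊖ Q' P x)))))) distinct))

    module _ (torsionFree : TorsionFree G) (k w : ℕ) (hk : + 16 * (+ 3) ^ k ≤ (+ 4) ^ k) (2k≡1+w : k ℕ.+ k ≡ suc w) where

      -- Translation by `P` makes its neighbours sparse without changing their agreement. The
      -- inequality in `near` is strict, so the weights are at most `2k - 1`, which is `w`.
      near-list : ∀ {n} m (f : Vec Bool n → Carrier) Ps P → AllPairs DistinctFn Ps → All (Good m f) Ps →
                  ∑ Ps (near (k ℕ.+ k) P) ≤ sparseBound (+ m) w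
      near-list {n} m f Ps P distinct good = subst₂ _≤_
          (trans (cong +_ (length-map (_⊖ P) Qs)) (∣filter∣ near? Ps)) (ℤ.*-identityˡ (sparseBound (+ m) w))
          (sparse-list m w 1ℤ (translate f P) (map (_⊖ P) Qs) (0≤+ 1)
            (multiplicity-translate P Qs (AllPairs.filter⁺ near? distinct))
            (All.map⁺ (All.map (λ {Q} → good-translate {m = m} f P Q) (All.filter⁺ near? good)))
            (All.map⁺ (All.map (λ {Q} l → ℕ.s≤s⁻¹ (subst (weight (proj₂ (Q ⊖ P)) ℕ.<_) 2k≡1+w l)) (All.all-filter near? Ps))))
        where
        near? : Decidable₁ (λ Q → weight (proj₂ (Q ⊖ P)) ℕ.< k ℕ.+ k)
        near? Q = weight (proj₂ (Q ⊖ P)) ℕ.<? (k ℕ.+ k)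
        Qs = filter near? Ps

      -- By averaging `many-near-pairs`, some `P` has at least a `1/m` fraction of the list near it.
      list-bound : ∀ {n} m .{{_ : ℕ.NonZero m}} (f : Vec Bool n → Carrier) Ps → AllPairs DistinctFn Ps → All (Good m f) Ps →
                   ∣ Ps ∣ ≤ + m * sparseBound (+ m) w
      list-bound m f []           distinct good = 0≤+ m ⊗ 0≤sparseBound m w
      list-bound m f Ps@(P₀ ∷ Ps') distinct good with Any.satisfied (pigeonhole P₀ Ps' (λ P → + m * ∑ Ps (near (k ℕ.+ k) P)) (∣ Ps ∣)
        (ℤ.≤-trans (many-near-pairs torsionFree k hk m f Ps good) (ℤ.≤-reflexive (sym (∑-* Ps (+ m) (λ P → ∑ Ps (near (k ℕ.+ k) P)))))))
      ... | P , L≤ = ℤ.≤-trans L≤ (ℤ.*-monoˡ-≤-nonNeg (+ m) (near-list m f Ps P distinct good))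

      -- In the exponent, 1 comes from passing to a neighbourhood and 3 from each of the `w` steps
      -- of the sparse induction.
      list-bound-ℕ : ∀ {n} m .{{_ : ℕ.NonZero m}} (f : Vec Bool n → Carrier) Ps → AllPairs DistinctFn Ps → All (Good m f) Ps →
                     length Ps ℕ.≤ sparseConstant w ℕ.* m ℕ.^ (1 ℕ.+ 3 ℕ.* w)
      list-bound-ℕ m f Ps distinct good = ℤ.drop‿+≤+ (ℤ.≤-trans (list-bound m f Ps distinct good)
        (ℤ.≤-trans (ℤ.*-monoˡ-≤-nonNeg (+ m) (sparseBound≤ m w)) (ℤ.≤-reflexive power)))
        where
        open ≡-Reasoning
        swap : ∀ m c e → m * (c * e) ≡ c * (m * e)
        swap = solve-∀
        triple : ∀ m → m * m * m ≡ m * (m * (m * 1ℤ))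
        triple = solve-∀
        power : + m * (+ sparseConstant w * (+ m * + m * + m) ^ w) ≡ + (sparseConstant w ℕ.* m ℕ.^ (1 ℕ.+ 3 ℕ.* w))
        power = begin
          + m * (+ sparseConstant w * (+ m * + m * + m) ^ w) ≡⟨ swap (+ m) (+ sparseConstant w) ((+ m * + m * + m) ^ w) ⟩
          + sparseConstant w * (+ m * (+ m * + m * + m) ^ w) ≡⟨ cong (λ z → + sparseConstant w * (+ m * z ^ w)) (triple (+ m)) ⟩
          + sparseConstant w * (+ m * ((+ m) ^ 3) ^ w)       ≡⟨ cong (λ z → + sparseConstant w * (+ m * z)) (ℤ.^-*-assoc (+ m) 3 w) ⟩
          + sparseConstant w * (+ m) ^ (1 ℕ.+ 3 ℕ.* w)       ≡⟨ cong (+ sparseConstant w *_) (pos-^ m (1 ℕ.+ 3 ℕ.* w)) ⟩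
          + sparseConstant w * + (m ℕ.^ (1 ℕ.+ 3 ℕ.* w))     ≡⟨ sym (ℤ.pos-* (sparseConstant w) (m ℕ.^ (1 ℕ.+ 3 ℕ.* w))) ⟩
          + (sparseConstant w ℕ.* m ℕ.^ (1 ℕ.+ 3 ℕ.* w)) ∎

    -- From rational distance to integer agreement, and the final bound.

    disagree≡ : ∀ {n} (f : Vec Bool n → Carrier) P → + disagree f P ≡ 2^ n - agreement f P
    disagree≡ {n} f P = trans (∣filter∣ (λ x → ¬? (f x ≟ eval P x)) (cube n)) (isolate (agreement f P) (2^ n) _
      (trans (sym (∑-+ (cube n) (λ x → χ (f x) (eval P x)) (λ x → ind (¬? (f x ≟ eval P x)))))
        (trans (∑-cong (cube n) (λ x → complement (f x ≟ eval P x))) (∑-cube-1 n))))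
      where
      complement : ∀ {X : Set} (d : Dec X) → ind d + ind (¬? d) ≡ 1ℤ
      complement (yes _) = refl
      complement (no _)  = refl
      cancel : ∀ a d → d ≡ a + d - a
      cancel = solve-∀
      isolate : ∀ a N d → a + d ≡ N → d ≡ N - a
      isolate a N d refl = cancel a d

    disagree≤ : ∀ {n} (f : Vec Bool n → Carrier) s d .(coprime : Coprime (suc s) (suc d)) P → InList f (mkℚ ℤ.+[1+ s ] d coprime) P →
                + disagree f P * (+ 2 * + suc d) ℤ.≤ (+ suc d - + 2 * + suc s) * 2^ n
    disagree≤ {n} f s d coprime P h = cleared (2 ℕ.^ n) {{ℕ.m^n≢0 2 n}} h
      where
      ε' = mkℚ ℤ.+[1+ s ] d coprime
      identity : ∀ s d → (1ℤ * d + (ℤ.- s) * + 2) ≡ d - + 2 * s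
      identity = solve-∀
      -- An arbitrary nonzero denominator replaces `2 ^ n`, so that it can be matched as a successor
      -- and the unnormalised fraction computes.
      cleared : ∀ N .{{_ : ℕ.NonZero N}} → (+ disagree f P) / N ℚ.≤ ℚ.½ ℚ.- ε' →
              + disagree f P * (+ 2 * + suc d) ℤ.≤ (+ suc d - + 2 * + suc s) * + N
      cleared (suc N) h with ℚᵘ.≤-respʳ-≃ (ℚᵘ.≃-trans (ℚ.toℚᵘ-homo-+ ℚ.½ (ℚ.- ε')) (ℚᵘ.+-congʳ (ℚ.toℚᵘ ℚ.½) (ℚ.toℚᵘ-homo‿- ε')))
                             (ℚᵘ.≤-respˡ-≃ (toℚᵘ-/ (+ disagree f P) (suc N)) (ℚ.toℚᵘ-mono-≤ h))
      ... | *≤* h' = subst (λ z → + disagree f P * (+ 2 * + suc d) ℤ.≤ z * + suc N) (identity (+ suc s) (+ suc d)) h'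

    -- Here ε is `suc s` over `suc d`, and the hypothesis on `m` says that `1/m` is at most ε.
    inList⇒good : ∀ {n} (f : Vec Bool n → Carrier) s d .(coprime : Coprime (suc s) (suc d)) m P → suc d ℕ.≤ m ℕ.* suc s →
                  InList f (mkℚ ℤ.+[1+ s ] d coprime) P → Good m f P
    inList⇒good {n} f s d coprime m P d≤ms h = arithmetic (+ suc s) (+ suc d) (+ m) (2^ n) (agreement f P) (0≤+ m) (0≤2^ n)
        (subst (+ suc d ℤ.≤_) (ℤ.pos-* m (suc s)) (+≤+ d≤ms))
        (subst (λ z → z * (+ 2 * + suc d) ℤ.≤ (+ suc d - + 2 * + suc s) * 2^ n) (disagree≡ f P) (disagree≤ f s d coprime P h))
      where
      arithmetic : ∀ s d m N a .{{_ : ℤ.Positive d}} → 0ℤ ℤ.≤ m → 0ℤ ℤ.≤ N → d ℤ.≤ m * s →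
                   (N - a) * (+ 2 * d) ℤ.≤ (d - + 2 * s) * N → N * (m + + 2) ℤ.≤ (+ 2 * m) * a
      arithmetic s d m N a 0≤m 0≤N d≤ h = cancel-≤ d (≤-by _ (0≤m ⊗ gap h ⊕ (0≤+ 2 ⊗ 0≤N) ⊗ gap d≤) (identity s d m N a))
        where
        identity : ∀ s d m N a → d * ((+ 2 * m) * a) ≡ d * (N * (m + + 2)) +
          (m * ((d - + 2 * s) * N - (N - a) * (+ 2 * d)) + (+ 2 * N) * (m * s - d))
        identity = solve-∀

    -- A distance is nonnegative, so membership forces ε to be at most 1/2. The weaker bound 1
    -- suffices for rounding 1/ε.
    inList⇒ε≤1 : ∀ {n} (f : Vec Bool n → Carrier) s d .(coprime : Coprime (suc s) (suc d)) P →
                  InList f (mkℚ ℤ.+[1+ s ] d coprime) P → suc s ℕ.≤ suc d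
    inList⇒ε≤1 {n} f s d coprime P h = ℤ.drop‿+≤+ (arithmetic (+ suc s) (+ suc d) (2^ n) (+ disagree f P) {{2^-positive n}}
        (0≤+ (disagree f P)) (0≤+ (suc d)) (0≤+ (suc s)) (0≤2^ n) (disagree≤ f s d coprime P h))
      where
      arithmetic : ∀ s d N x .{{_ : ℤ.Positive N}} → 0ℤ ℤ.≤ x → 0ℤ ℤ.≤ d → 0ℤ ℤ.≤ s → 0ℤ ℤ.≤ N →
                   x * (+ 2 * d) ℤ.≤ (d - + 2 * s) * N → s ℤ.≤ d
      arithmetic s d N x 0≤x 0≤d 0≤s 0≤N h = cancel-≤ N (≤-by _ (gap h ⊕ 0≤x ⊗ (0≤+ 2 ⊗ 0≤d) ⊕ 0≤N ⊗ 0≤s) (identity s d N x))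
        where
        identity : ∀ s d N x → N * d ≡ N * s + ((d - + 2 * s) * N - x * (+ 2 * d) + x * (+ 2 * d) + N * s)
        identity = solve-∀

  module _ (k w : ℕ) (hk : + 16 * (+ 3) ℤ.^ k ℤ.≤ (+ 4) ℤ.^ k) (2k≡1+w : k ℕ.+ k ≡ suc w) where

    polynomial-bound : ∀ (Fs : List PGroupFactor) (ε : ℚ) .{{_ : Positive ε}} (n : ℕ)
      (f : Vec Bool n → FinAbGroup.Carrier (prodFactors Fs)) (Ps : List (Poly.Coeffs (prodFactors Fs) n)) →
      AllPairs (Poly.DistinctFn (prodFactors Fs)) Ps → All (Poly.InList (prodFactors Fs) f ε) Ps →
      ι (length Ps) ℚ.≤ ι (sparseConstant w ℕ.* 2 ℕ.^ (1 ℕ.+ 3 ℕ.* w)) ℚ.* ((1/ ε) {{pos⇒nonZero ε}} ^ℚ (1 ℕ.+ 3 ℕ.* w))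
    -- Without a member of the list ε may exceed 1, so this case uses only that the right side is
    -- nonnegative.
    polynomial-bound Fs (mkℚ ℤ.+[1+ s ] d coprime) n f [] distinct close =
      ℚ.nonNegative⁻¹ _ {{ℚ.nonNeg*nonNeg⇒nonNeg (ι (sparseConstant w ℕ.* 2 ℕ.^ (1 ℕ.+ 3 ℕ.* w)))
        {{ι-nonNeg (sparseConstant w ℕ.* 2 ℕ.^ (1 ℕ.+ 3 ℕ.* w))}} _ {{^ℚ-nonNeg (mkℚ ℤ.+[1+ d ] s (Coprimality.sym coprime)) (1 ℕ.+ 3 ℕ.* w)}}}}
    polynomial-bound Fs (mkℚ ℤ.+[1+ s ] d coprime) n f Ps@(P ∷ _) distinct close@(close₀ ∷ _) =
      rational-bound (sparseConstant w) (1 ℕ.+ 3 ℕ.* w) (length Ps) (suc (suc d ℕ./ suc s)) _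
        (Polynomials.list-bound-ℕ (prodFactors Fs) (torsionFree Fs) k w hk 2k≡1+w (suc (suc d ℕ./ suc s)) f Ps distinct
          (All.map (λ {Q} → Polynomials.inList⇒good (prodFactors Fs) f s d coprime (suc (suc d ℕ./ suc s)) Q (ceiling-≥ d s)) close))
        (ceiling-≤ d s (Coprimality.sym coprime) (Polynomials.inList⇒ε≤1 (prodFactors Fs) f s d coprime P close₀))

open import Data.Rational using (_≤_; _*_)

-- 944784 is at most 1048576; 10 is the least exponent for which this holds.
16·3¹⁰≤4¹⁰ : (+ 16) ℤ.* (+ 3) ℤ.^ 10 ℤ.≤ (+ 4) ℤ.^ 10
16·3¹⁰≤4¹⁰ = from-yes (((+ 16) ℤ.* (+ 3) ℤ.^ 10) ℤ.≤? ((+ 4) ℤ.^ 10))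

theorem4p4 : Σ ℕ λ C → Σ ℕ λ d →
    ∀ (Fs : List PGroupFactor) (ε : ℚ) .{{_ : Positive ε}} (n : ℕ)
    (f : Vec Bool n → FinAbGroup.Carrier (prodFactors Fs))
    (Ps : List (Poly.Coeffs (prodFactors Fs) n)) →
    AllPairs (Poly.DistinctFn (prodFactors Fs)) Ps →
    All (Poly.InList (prodFactors Fs) f ε) Ps →
    (+ length Ps) / 1 ≤ ((+ C) / 1) * ((1/ ε) {{pos⇒nonZero ε}} ^ℚ d)
-- With `k = 10` the weight bound is `2k - 1 = 19` and the exponent is `1 + 3 * 19 = 58`; the factor
-- `2 ^ 58` pays for replacing 1/ε by an integer of size at most 2/ε.
theorem4p4 = Counting.sparseConstant 19 ℕ.* 2 ℕ.^ 58 , 58 , Counting.polynomial-bound 10 19 16·3¹⁰≤4¹⁰ refl
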